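{- There is a deterministic algorithm which, given matrices $A^{(1)},\dots,A^{(m)}$ with $A^{(j)}\in\mathbb R^{r_j\times r}$, decides in time $\mathrm{poly}(D,r)$, where $D:=\sum_{j=1}^m\operatorname{rank}A^{(j)}$, whether $$\sum_{j=1}^m \operatorname{rank}\bigl(A^{(j)}_S\bigr)\ \ge\ 2|S|+m-1\qquad\text{for every }S\subseteq[r]\text{ with }|S|\ge 2 ,$$ where $A^{(j)}_S$ denotes the restriction of $A^{(j)}$ to the columns indexed by $S$.
   Context: $[r]=\{1,\dots,r\}$. The matrices are the factor matrices of a compressed tensor, i.e. $\operatorname{rank}A^{(j)}=r_j\geq 1$ for every $j$. Computational model: the algebraic model over $\mathbb R$, time being the number of arithmetic operations on real numbers (comparisons included). -}

module Defs where

open import Algebra.Bundles using (CommutativeRing)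
import Algebra.Definitions.RawMonoid as RawMonoidDefs
import Algebra.Properties.Ring as RingProperties
import Algebra.Properties.Semiring.Sum as SemiringSum
open import Data.Bool.Base using (Bool; if_then_else_)
open import Data.Fin.Base using (Fin; zero; suc)
open import Data.Fin.Properties as Fin using (any?)
open import Data.Fin.Subset using (Subset; _∈_; _∉_; _⊆_; ∣_∣; ⊥) renaming (_-_ to _∖_)
open import Data.Fin.Subset.Properties
  using (_∈?_; _⊆?_; nonempty?; anySubset?; ∣p∣≤n; ∣⊥∣≡0; ⊥⊆; ∉⊥; p─q⊆p;
         x∈p∧x≢y⇒x∈p-y)
open import Data.Maybe.Base using (Maybe; just; nothing; _>>=_; map)
open import Data.Nat.Base as ℕ using (ℕ)
import Data.Nat.Properties as ℕ
open import Data.Product.Base using (Σ; ∃; _×_; _,_; proj₁; proj₂; map₂)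
open import Data.Vec.Base as Vec using (Vec; []; _∷_)
open import Function.Base using (_∘_; case_of_)
open import Level using (0ℓ)
open import Relation.Binary.Core using (Rel)
open import Relation.Binary.PropositionalEquality as ≡ using (_≡_; _≢_)
import Relation.Binary.Reasoning.Setoid as SetoidReasoning
open import Relation.Binary.Structures using (IsStrictTotalOrder)
open import Relation.Nullary
  using (¬_; Dec; yes; no; does; ¬?; contradiction; _×-dec_)
open import Relation.Nullary.Decidable using (map′; decidable-stable)

-- The real numbers, characterised classically as the complete ordered field.
-- Trichotomy is what makes the comparisons of the algebraic model available;
-- it is contained in `IsStrictTotalOrder`.
record Reals : Set₁ where
  infix 4 _<_ _≤_
  field
    commutativeRing : CommutativeRing 0ℓ 0ℓ

  open CommutativeRing commutativeRing public hiding (zero)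

  field
    _<_                : Rel Carrier 0ℓ
    isStrictTotalOrder : IsStrictTotalOrder _≈_ _<_
    0<1                : 0# < 1#
    +-monoˡ-<          : ∀ z {x y} → x < y → x + z < y + z
    *-pos              : ∀ {x y} → 0# < x → 0# < y → 0# < x * y
    inverse            : ∀ x → ¬ x ≈ 0# → ∃ λ y → x * y ≈ 1#

  open IsStrictTotalOrder isStrictTotalOrder public
    using (compare; _≟_; _<?_)

  _≤_ : Rel Carrier 0ℓ
  x ≤ y = ¬ y < x

  UpperBound : (Carrier → Set) → Carrier → Set
  UpperBound P u = ∀ {x} → P x → x ≤ u

  field
    complete : (P : Carrier → Set) → ∃ P → ∃ (UpperBound P) →
               ∃ λ s → UpperBound P s × (∀ {u} → UpperBound P u → s ≤ u)

sumℕ : ∀ {n} → (Fin n → ℕ) → ℕ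
sumℕ = RawMonoidDefs.sum ℕ.+-0-rawMonoid

module _ (ℝ : Reals) where
  open Reals ℝ

  Matrix : ℕ → ℕ → Set
  Matrix p q = Fin p → Fin q → Carrier

module LinearAlgebra (ℝ : Reals) where
  open Reals ℝ
  open SemiringSum semiring
    using (sum; sum-cong-≋; sum-replicate-zero; ∑-distrib-+; *-distribʳ-sum)
  open RingProperties ring using (-‿distribˡ-*; -‿distribʳ-*)
  open SetoidReasoning setoid

  -- The family of the columns of A with index in T is linearly independent.
  -- Linear combinations of that family are those combinations of all the
  -- columns whose coefficients vanish outside T.
  Independent : ∀ {p q} → Matrix ℝ p q → Subset q → Set
  Independent {q = q} A T =
    ∀ (c : Fin q → Carrier) → (∀ i → i ∉ T → c i ≈ 0#) →
    (∀ a → sum (λ i → c i * A a i) ≈ 0#) → ∀ i → c i ≈ 0#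

  -- k is the rank of the submatrix of A formed by the columns in S: the
  -- largest size of a linearly independent subfamily of these columns.
  IsRank : ∀ {p q} → Matrix ℝ p q → Subset q → ℕ → Set
  IsRank A S k =
    (∃ λ T → T ⊆ S × Independent A T × ∣ T ∣ ≡ k) ×
    (∀ T → T ⊆ S → Independent A T → ∣ T ∣ ℕ.≤ k)

  private
    sum-zero : ∀ {n} (f : Fin n → Carrier) → (∀ i → f i ≈ 0#) → sum f ≈ 0#
    sum-zero {n} f f≈0 = trans (sum-cong-≋ f≈0) (sum-replicate-zero n)

    -- Adding t to the coefficient of q.
    bump : ∀ {n} → Fin n → Carrier → (Fin n → Carrier) → Fin n → Carrier
    bump q t c i = if does (i Fin.≟ q) then c i + t else c i

    bump-≢ : ∀ {n} {q i : Fin n} t c → i ≢ q → bump q t c i ≡ c i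
    bump-≢ {q = q} {i} t c i≢q with i Fin.≟ q
    ... | yes i≡q = contradiction i≡q i≢q
    ... | no  _   = ≡.refl

    bump-≡ : ∀ {n} (q : Fin n) t c → bump q t c q ≡ c q + t
    bump-≡ q t c with q Fin.≟ q
    ... | yes _   = ≡.refl
    ... | no  q≢q = contradiction ≡.refl q≢q

    swap-last : ∀ x y z → (x + y) + z ≈ (x + z) + y
    swap-last x y z = begin
      (x + y) + z  ≈⟨ +-assoc x y z ⟩
      x + (y + z)  ≈⟨ +-congˡ (+-comm y z) ⟩
      x + (z + y)  ≈⟨ +-assoc x z y ⟨
      (x + z) + y  ∎

    sum-bump : ∀ {n} (q : Fin n) t c (v : Fin n → Carrier) →
               sum (λ i → bump q t c i * v i) ≈ sum (λ i → c i * v i) + t * v q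
    sum-bump zero t c v = begin
      (c zero + t) * v zero + sum (λ i → c (suc i) * v (suc i))
        ≈⟨ +-congʳ (distribʳ (v zero) (c zero) t) ⟩
      (c zero * v zero + t * v zero) + sum (λ i → c (suc i) * v (suc i))
        ≈⟨ swap-last _ _ _ ⟩
      (c zero * v zero + sum (λ i → c (suc i) * v (suc i))) + t * v zero ∎
    sum-bump (suc q) t c v = begin
      c zero * v zero + sum (λ i → bump (suc q) t c (suc i) * v (suc i))
        ≈⟨ +-congˡ (sum-cong-≋ (λ i → *-congʳ (reflexive (bump-suc i)))) ⟩
      c zero * v zero + sum (λ i → bump q t (c ∘ suc) i * v (suc i))
        ≈⟨ +-congˡ (sum-bump q t (c ∘ suc) (v ∘ suc)) ⟩
      c zero * v zero + (sum (λ i → c (suc i) * v (suc i)) + t * v (suc q))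
        ≈⟨ +-assoc _ _ _ ⟨
      (c zero * v zero + sum (λ i → c (suc i) * v (suc i))) + t * v (suc q) ∎
      where
      bump-suc : ∀ i → bump (suc q) t c (suc i) ≡ bump q t (c ∘ suc) i
      bump-suc i with i Fin.≟ q
      ... | yes _ = ≡.refl
      ... | no  _ = ≡.refl

    ∉∖ : ∀ {n} (T : Subset n) q → q ∉ T ∖ q
    ∉∖ (_ ∷ T) zero    ()
    ∉∖ (_ ∷ T) (suc q) (Vec.there q∈) = ∉∖ T q q∈

    cancelʳ : ∀ {x y} → ¬ y ≈ 0# → x * y ≈ 0# → x ≈ 0#
    cancelʳ {x} {y} y≉0 xy≈0 with inverse y y≉0
    ... | z , yz≈1 = begin
      x            ≈⟨ *-identityʳ x ⟨
      x * 1#       ≈⟨ *-congˡ yz≈1 ⟨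
      x * (y * z)  ≈⟨ *-assoc x y z ⟨
      (x * y) * z  ≈⟨ *-congʳ xy≈0 ⟩
      0# * z       ≈⟨ zeroˡ z ⟩
      0#           ∎

    -- One step of Gaussian elimination: the column q, with nonzero entry in
    -- the first row, is used to clear the first row of the other columns.
    module Pivot {p n} (A : Matrix ℝ (ℕ.suc p) n) (T : Subset n)
                 (q : Fin n) (q∈T : q ∈ T) (pivot≉0 : ¬ A zero q ≈ 0#) where

      z : Carrier
      z = proj₁ (inverse (A zero q) pivot≉0)

      pivot*z≈1 : A zero q * z ≈ 1#
      pivot*z≈1 = proj₂ (inverse (A zero q) pivot≉0)

      -- The multiple of the column q subtracted from the column i.
      factor : Fin n → Carrier
      factor i = - (A zero i * z)

      A′ : Matrix ℝ p n
      A′ a i = A (suc a) i + factor i * A (suc a) q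

      T′ : Subset n
      T′ = T ∖ q

      row₀ : (Fin n → Carrier) → Carrier
      row₀ c = sum (λ i → c i * A zero i)

      sum-A′ : ∀ c a → sum (λ i → c i * A′ a i) ≈
               sum (λ i → c i * A (suc a) i) + (- (row₀ c * z)) * A (suc a) q
      sum-A′ c a = begin
        sum (λ i → c i * A′ a i)
          ≈⟨ sum-cong-≋ term ⟩
        sum (λ i → c i * A (suc a) i + (c i * A zero i) * w)
          ≈⟨ ∑-distrib-+ (λ i → c i * A (suc a) i) _ ⟩
        sum (λ i → c i * A (suc a) i) + sum (λ i → (c i * A zero i) * w)
          ≈⟨ +-congˡ (*-distribʳ-sum w (λ i → c i * A zero i)) ⟨
        sum (λ i → c i * A (suc a) i) + row₀ c * w
          ≈⟨ +-congˡ (out (row₀ c)) ⟩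
        sum (λ i → c i * A (suc a) i) + (- (row₀ c * z)) * A (suc a) q ∎
        where
        w = - (z * A (suc a) q)

        out : ∀ x → x * w ≈ (- (x * z)) * A (suc a) q
        out x = begin
          x * - (z * A (suc a) q)    ≈⟨ -‿distribʳ-* _ _ ⟨
          - (x * (z * A (suc a) q))  ≈⟨ -‿cong (*-assoc _ _ _) ⟨
          - ((x * z) * A (suc a) q)  ≈⟨ -‿distribˡ-* _ _ ⟩
          - (x * z) * A (suc a) q    ∎

        term : ∀ i → c i * A′ a i ≈ c i * A (suc a) i + (c i * A zero i) * w
        term i = begin
          c i * (A (suc a) i + factor i * A (suc a) q)
            ≈⟨ distribˡ _ _ _ ⟩
          c i * A (suc a) i + c i * (factor i * A (suc a) q)
            ≈⟨ +-congˡ (*-congˡ (out (A zero i))) ⟨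
          c i * A (suc a) i + c i * (A zero i * w)
            ≈⟨ +-congˡ (*-assoc _ _ _) ⟨
          c i * A (suc a) i + (c i * A zero i) * w ∎

      from : Independent A′ T′ → Independent A T
      from ind c c∉T Ac≈0 i = case i Fin.≟ q of λ where
          (yes ≡.refl) → cq≈0
          (no  i≢q)    → others i i≢q
        where
        c′ = bump q (- c q) c

        c′q≈0 : c′ q ≈ 0#
        c′q≈0 = trans (reflexive (bump-≡ q (- c q) c)) (-‿inverseʳ (c q))

        c′∉T′ : ∀ i → i ∉ T′ → c′ i ≈ 0#
        c′∉T′ i i∉T′ with i Fin.≟ q
        ... | yes ≡.refl = -‿inverseʳ (c q)
        ... | no  i≢q    = c∉T i (λ i∈T → i∉T′ (x∈p∧x≢y⇒x∈p-y i∈T i≢q))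

        row-c′ : row₀ c′ ≈ (- c q) * A zero q
        row-c′ = begin
          row₀ c′                          ≈⟨ sum-bump q (- c q) c (A zero) ⟩
          row₀ c + (- c q) * A zero q      ≈⟨ +-congʳ (Ac≈0 zero) ⟩
          0# + (- c q) * A zero q          ≈⟨ +-identityˡ _ ⟩
          (- c q) * A zero q               ∎

        A′c′≈0 : ∀ a → sum (λ i → c′ i * A′ a i) ≈ 0#
        A′c′≈0 a = begin
          sum (λ i → c′ i * A′ a i)
            ≈⟨ sum-A′ c′ a ⟩
          sum (λ i → c′ i * A (suc a) i) + (- (row₀ c′ * z)) * A (suc a) q
            ≈⟨ +-cong (sum-bump q (- c q) c (A (suc a))) (*-congʳ (-‿cong row*z)) ⟩
          (sum (λ i → c i * A (suc a) i) + (- c q) * A (suc a) q)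
            + (- (- c q)) * A (suc a) q
            ≈⟨ +-congʳ (trans (+-congʳ (Ac≈0 (suc a))) (+-identityˡ _)) ⟩
          (- c q) * A (suc a) q + (- (- c q)) * A (suc a) q
            ≈⟨ distribʳ _ _ _ ⟨
          (- c q + - (- c q)) * A (suc a) q
            ≈⟨ *-congʳ (-‿inverseʳ (- c q)) ⟩
          0# * A (suc a) q
            ≈⟨ zeroˡ _ ⟩
          0# ∎
          where
          row*z : row₀ c′ * z ≈ - c q
          row*z = begin
            row₀ c′ * z                 ≈⟨ *-congʳ row-c′ ⟩
            ((- c q) * A zero q) * z    ≈⟨ *-assoc _ _ _ ⟩
            (- c q) * (A zero q * z)    ≈⟨ *-congˡ pivot*z≈1 ⟩
            (- c q) * 1#                ≈⟨ *-identityʳ _ ⟩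
            - c q                       ∎

        c′≈0 : ∀ i → c′ i ≈ 0#
        c′≈0 = ind c′ c′∉T′ A′c′≈0

        others : ∀ i → i ≢ q → c i ≈ 0#
        others i i≢q = trans (reflexive (≡.sym (bump-≢ (- c q) c i≢q))) (c′≈0 i)

        -cq≈0 : - c q ≈ 0#
        -cq≈0 = cancelʳ pivot≉0 (trans (sym row-c′)
          (sum-zero _ (λ i → trans (*-congʳ (c′≈0 i)) (zeroˡ _))))

        cq≈0 : c q ≈ 0#
        cq≈0 = begin
          c q          ≈⟨ +-identityʳ _ ⟨
          c q + 0#     ≈⟨ +-congˡ -cq≈0 ⟨
          c q + - c q  ≈⟨ -‿inverseʳ _ ⟩
          0#           ∎

      to : Independent A T → Independent A′ T′
      to ind c′ c′∉T′ A′c′≈0 i = case i Fin.≟ q of λ where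
          (yes ≡.refl) → c′∉T′ q (∉∖ T q)
          (no  i≢q)    → trans (reflexive (≡.sym (bump-≢ t c′ i≢q)))
                               (ind c c∉T Ac≈0 i)
        where
        t = - (row₀ c′ * z)
        c = bump q t c′

        c∉T : ∀ i → i ∉ T → c i ≈ 0#
        c∉T i i∉T = trans (reflexive (bump-≢ t c′ (λ { ≡.refl → i∉T q∈T })))
          (c′∉T′ i (i∉T ∘ p─q⊆p T _))

        Ac≈0 : ∀ a → sum (λ i → c i * A a i) ≈ 0#
        Ac≈0 zero = begin
          row₀ c
            ≈⟨ sum-bump q t c′ (A zero) ⟩
          row₀ c′ + (- (row₀ c′ * z)) * A zero q
            ≈⟨ +-congˡ (-‿distribˡ-* _ _) ⟨
          row₀ c′ + - ((row₀ c′ * z) * A zero q)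
            ≈⟨ +-congˡ (-‿cong (*-assoc _ _ _)) ⟩
          row₀ c′ + - (row₀ c′ * (z * A zero q))
            ≈⟨ +-congˡ (-‿cong (*-congˡ (trans (*-comm _ _) pivot*z≈1))) ⟩
          row₀ c′ + - (row₀ c′ * 1#)
            ≈⟨ +-congˡ (-‿cong (*-identityʳ _)) ⟩
          row₀ c′ + - row₀ c′
            ≈⟨ -‿inverseʳ _ ⟩
          0# ∎
        Ac≈0 (suc a) = begin
          sum (λ i → c i * A (suc a) i)
            ≈⟨ sum-bump q t c′ (A (suc a)) ⟩
          sum (λ i → c′ i * A (suc a) i) + t * A (suc a) q
            ≈⟨ sum-A′ c′ a ⟨
          sum (λ i → c′ i * A′ a i)
            ≈⟨ A′c′≈0 a ⟩
          0# ∎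

  independent? : ∀ {p q} (A : Matrix ℝ p q) T → Dec (Independent A T)
  independent? {ℕ.zero} A T with nonempty? T
  ... | no  T≡∅       = yes λ c c∉T _ i → c∉T i (λ i∈T → T≡∅ (i , i∈T))
  ... | yes (q , q∈T) = no λ ind → 1≉0 (begin
      1#                        ≈⟨ +-identityˡ 1# ⟨
      0# + 1#                   ≡⟨ bump-≡ q 1# (λ _ → 0#) ⟨
      bump q 1# (λ _ → 0#) q    ≈⟨ ind (bump q 1# (λ _ → 0#)) supp (λ ()) q ⟩
      0#                        ∎)
    where
    1≉0 : ¬ 1# ≈ 0#
    1≉0 1≈0 = IsStrictTotalOrder.irrefl isStrictTotalOrder (sym 1≈0) 0<1

    supp : ∀ i → i ∉ T → bump q 1# (λ _ → 0#) i ≈ 0#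
    supp i i∉T =
      reflexive (bump-≢ {i = i} 1# (λ _ → 0#) (λ { ≡.refl → i∉T q∈T }))
  independent? {ℕ.suc p} A T with any? (λ q → q ∈? T ×-dec ¬? (A zero q ≟ 0#))
  ... | yes (q , q∈T , pivot≉0) =
      map′ from to (independent? A′ T′)
    where open Pivot A T q q∈T pivot≉0
  ... | no  noPivot = map′
      (λ ind c c∉T Ac≈0 → ind c c∉T (Ac≈0 ∘ suc))
      (λ ind c c∉T Ac≈0 → ind c c∉T λ where
        zero    → sum-zero _ (row₀ c c∉T)
        (suc a) → Ac≈0 a)
      (independent? (A ∘ suc) T)
    where
    row₀ : ∀ c → (∀ i → i ∉ T → c i ≈ 0#) → ∀ i → c i * A zero i ≈ 0#
    row₀ c c∉T i with i ∈? T
    ... | no  i∉T = trans (*-congʳ (c∉T i i∉T)) (zeroˡ _)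
    ... | yes i∈T = trans (*-congˡ (decidable-stable (A zero i ≟ 0#)
                      (λ ≉0 → noPivot (i , i∈T , ≉0)))) (zeroʳ _)

  rank-exists : ∀ {p q} (A : Matrix ℝ p q) S → ∃ (IsRank A S)
  rank-exists {q = q} A S = search q (λ T _ _ → ∣p∣≤n T)
    where
    search : ∀ k → (∀ T → T ⊆ S → Independent A T → ∣ T ∣ ℕ.≤ k) →
             ∃ (IsRank A S)
    search k bound with anySubset?
      (λ T → T ⊆? S ×-dec independent? A T ×-dec ∣ T ∣ ℕ.≟ k)
    search k          bound | yes T  = k , T , bound
    search ℕ.zero     bound | no  ¬T = 0 , (⊥ , ⊥⊆ , ind , ∣⊥∣≡0 q) , bound
      where
      ind : Independent A ⊥
      ind c c∉⊥ _ i = c∉⊥ i ∉⊥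
    search (ℕ.suc k)  bound | no  ¬T = search k λ T T⊆S ind →
      ℕ.≤-pred (ℕ.≤∧≢⇒< (bound T T⊆S ind) λ ∣T∣≡1+k → ¬T (T , T⊆S , ind , ∣T∣≡1+k))

  -- rank A S is the rank of the restriction of A to the columns in S; in
  -- particular rank A ⊤ is the rank of A itself.
  rank : ∀ {p q} → Matrix ℝ p q → Subset q → ℕ
  rank A S = proj₁ (rank-exists A S)

-- Algebraic computation trees.  `Tree I n` is what remains to be executed once
-- n values have been computed from inputs indexed by I; the latest value has
-- index zero.  Trees do not mention the reals: they have access to them only
-- through the four operations and comparisons.
data Operand (I : Set) (n : ℕ) : Set where
  input   : I → Operand I n
  value   : Fin n → Operand I n
  𝟘 𝟙     : Operand I n

data Op : Set where
  add sub mul div : Op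

data Tree (I : Set) (n : ℕ) : Set where
  answer   : Bool → Tree I n
  compute  : Op → Operand I n → Operand I n → Tree I (ℕ.suc n) → Tree I n
  if_<_then_else_ : Operand I n → Operand I n → Tree I n → Tree I n → Tree I n

module Execution (ℝ : Reals) where
  open Reals ℝ

  apply : Op → Carrier → Carrier → Maybe Carrier
  apply add x y = just (x + y)
  apply sub x y = just (x - y)
  apply mul x y = just (x * y)
  apply div x y with y ≟ 0#
  ... | yes _   = nothing
  ... | no  y≉0 = just (x * proj₁ (inverse y y≉0))

  module _ {I : Set} (ρ : I → Carrier) where

    ⟦_⟧ : ∀ {n} → Operand I n → Vec Carrier n → Carrier
    ⟦ input i ⟧ vs = ρ i
    ⟦ value k ⟧ vs = Vec.lookup vs k
    ⟦ 𝟘 ⟧       vs = 0#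
    ⟦ 𝟙 ⟧       vs = 1#

    tick : Maybe (Bool × ℕ) → Maybe (Bool × ℕ)
    tick = map (map₂ ℕ.suc)

    -- The answer together with the time, i.e. the number of operations and
    -- comparisons executed; `nothing` if a division by zero is attempted.
    run : ∀ {n} → Tree I n → Vec Carrier n → Maybe (Bool × ℕ)
    run (answer b)                 vs = just (b , 0)
    run (compute o x y t)          vs =
      apply o (⟦ x ⟧ vs) (⟦ y ⟧ vs) >>= λ v → tick (run t (v ∷ vs))
    run (if x < y then t else u)   vs =
      tick (if does (⟦ x ⟧ vs <? ⟦ y ⟧ vs) then run t vs else run u vs)

-- The positions of the entries of matrices A⁽¹⁾, …, A⁽ᵐ⁾, the j-th of size d j × r.
Entry : (m r : ℕ) → (Fin m → ℕ) → Set
Entry m r d = Σ (Fin m) λ j → Fin (d j) × Fin r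

-- An algorithm whose input is m matrices of sizes d j × r.  It produces its
-- tree from the format of the input alone; being an Agda function, it does so
-- uniformly and effectively.
Algorithm : Set
Algorithm = (m r : ℕ) (d : Fin m → ℕ) → Tree (Entry m r d) 0

module _ (ℝ : Reals) where
  open Reals ℝ

  execute : Algorithm → ∀ {m r} {d : Fin m → ℕ} →
            ((j : Fin m) → Matrix ℝ (d j) r) → Maybe (Bool × ℕ)
  execute alg {m} {r} {d} A =
    Execution.run ℝ (λ { (j , a , i) → A j a i }) (alg m r d) []

module Submission where

-- The function S ↦ ∑ rank A⁽ʲ⁾_S + 1 − (2|S| + m) is submodular, and the question is
-- whether it is nonnegative on the sets with at least two elements.  For each pair
-- {a,b}, projected subgradient descent on the box [0,N]ʳ looks for a violating superset
-- of {a,b}.  A subgradient of the Lovász extension at y consists of the increments of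
-- the function along the chain that starts at {a,b} and adds the elements in descending
-- order of y; if a set of the chain is itself violating, the search stops.  Otherwise,
-- if S ⊇ {a,b} is violating, then each step brings y closer to the point N·1_S by a
-- fixed amount, so that polynomially many steps suffice.  The chain is evaluated through
-- ranks, these through greedy bases, and independence is tested by Gaussian elimination
-- without divisions.  Only operations on reals count, so the bookkeeping is free.

open import Defs
open import Data.Bool.Base using (Bool; true; false; if_then_else_)
open import Data.Fin.Base using (Fin; zero; suc; combine; remQuot)
import Data.Fin.Properties as Fin
open import Data.Fin.Subset using (Subset; _∈_; _∉_; _⊆_; ∣_∣; ⊤; ⊥; ⁅_⁆; _∩_; _∪_; inside; outside; Nonempty) renaming (_-_ to _∖_)
open import Data.Fin.Subset.Properties
open import Data.Integer.Base as ℤ using (ℤ; 0ℤ; +≤+)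
import Data.Integer.Properties as ℤ
open import Data.Integer.Tactic.RingSolver using (solve-∀)
open import Data.List.Base as List using (List; []; _∷_; length; allFin; filter; cartesianProductWith)
open import Data.List.Membership.Propositional using () renaming (_∈_ to _∈ˡ_)
open import Data.List.Membership.Propositional.Properties using (∈-allFin; ∈-filter⁺; ∈-cartesianProductWith⁺)
import Data.List.Properties as List
open import Data.List.Relation.Binary.Permutation.Propositional as Perm using (_↭_; ↭-sym; ↭-trans; ↭-reflexive)
open import Data.List.Relation.Binary.Permutation.Propositional.Properties using (All-resp-↭; ∈-resp-↭; ↭-length; map⁺)
open import Data.List.Relation.Unary.All as All using (All; []; _∷_)
import Data.List.Relation.Unary.All.Properties as All
open import Data.List.Relation.Unary.AllPairs using (AllPairs; []; _∷_)
open import Data.List.Relation.Unary.Any using (here; there)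
open import Data.List.Relation.Unary.Linked.Properties using (Linked⇒AllPairs)
import Data.List.Sort as Sort
open import Data.Maybe.Base as Maybe using (just)
open import Data.Nat.Base as ℕ using (ℕ; z≤n; s≤s)
import Data.Nat.Properties as ℕ
import Data.Nat.Tactic.RingSolver as ℕ-Solver
open import Data.Product.Base using (∃; ∃-syntax; _×_; _,_; proj₁; proj₂)
open import Data.Sum.Base as Sum using (_⊎_; inj₁; inj₂; [_,_]′)
open import Data.Vec.Base using (Vec; []; _∷_; here; there)
open import Function.Base using (_∘_; id)
open import Function.Bundles using (_⇔_; mk⇔; Equivalence)
open import Level using (0ℓ)
open import Relation.Binary.Bundles using (DecTotalOrder)
import Relation.Binary.Construct.Flip.EqAndOrd as Flip
import Relation.Binary.Construct.On as On
open import Relation.Binary.Definitions using (tri<; tri≈; tri>)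
open import Relation.Binary.PropositionalEquality as ≡ using (_≡_; _≢_)
open import Relation.Binary.Structures using (IsStrictTotalOrder)
open import Relation.Nullary using (¬_; Dec; yes; no; does; contradiction; ¬?)
open import Relation.Nullary.Decidable using (decidable-stable; does-⇔)
import Algebra.Properties.Ring as RingProperties
import Algebra.Properties.Semiring.Sum as SemiringSum
import Relation.Binary.Reasoning.Setoid as SetoidReasoning

-- Subsets

-- The restriction to |S| ≥ 2 forces the pairs: the function is negative on every singleton, and the
-- sets with at least two elements are not closed under intersection, whereas the sets above a fixed
-- pair form a lattice. Scaling the unit cube to side N lets every step have length 1 and keeps the
-- descent in the integers. With M a bound for the squared increments, a round loses at most r·M to
-- second-order terms and gains 2N from F S ≤ -1; so N = 1 + r·M leaves a gain of at least N per
-- round, against an initial squared distance of at most r·N². Stopping at a violating set is more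
-- than a shortcut: in a sweep that survives, the values along the chain are nonnegative, and this
-- is what bounds the extension at y from below in the summation by parts. A tree learns about the
-- reals only by comparisons, so the search is an adaptive program over Boolean independence
-- queries, and its time is bounded by a product of query counts.

q∉p∖q : ∀ {n} (p : Subset n) q → q ∉ p ∖ q
q∉p∖q (_ ∷ p) zero    ()
q∉p∖q (_ ∷ p) (suc q) (there q∈) = q∉p∖q p q q∈

p⊆p∖x∪⁅x⁆ : ∀ {n} (p : Subset n) x → p ⊆ (p ∖ x) ∪ ⁅ x ⁆
p⊆p∖x∪⁅x⁆ p x {y} y∈p with y Fin.≟ x
... | yes ≡.refl = x∈p∪q⁺ (inj₂ (x∈⁅x⁆ x))
... | no  y≢x    = x∈p∪q⁺ (inj₁ (x∈p∧x≢y⇒x∈p-y y∈p y≢x))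

p∪⁅x⁆⊆ : ∀ {n} {p q : Subset n} {x} → p ⊆ q → x ∈ q → p ∪ ⁅ x ⁆ ⊆ q
p∪⁅x⁆⊆ {p = p} {x = x} p⊆q x∈q y∈ with x∈p∪q⁻ p ⁅ x ⁆ y∈
... | inj₁ y∈p = p⊆q y∈p
... | inj₂ y∈x = ≡.subst (_∈ _) (≡.sym (x∈⁅y⁆⇒x≡y x y∈x)) x∈q

∪⁅⁆-monoˡ : ∀ {n} {p q : Subset n} x → p ⊆ q → p ∪ ⁅ x ⁆ ⊆ q ∪ ⁅ x ⁆
∪⁅⁆-monoˡ x p⊆q = p∪⁅x⁆⊆ (p⊆p∪q _ ∘ p⊆q) (x∈p∪q⁺ (inj₂ (x∈⁅x⁆ x)))

∣p∪q∣≤∣p∣+∣q∣ : ∀ {n} (p q : Subset n) → ∣ p ∪ q ∣ ℕ.≤ ∣ p ∣ ℕ.+ ∣ q ∣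
∣p∪q∣≤∣p∣+∣q∣ []            []            = ℕ.z≤n
∣p∪q∣≤∣p∣+∣q∣ (outside ∷ p) (outside ∷ q) = ∣p∪q∣≤∣p∣+∣q∣ p q
∣p∪q∣≤∣p∣+∣q∣ (outside ∷ p) (inside ∷ q)  =
  ℕ.≤-trans (ℕ.s≤s (∣p∪q∣≤∣p∣+∣q∣ p q)) (ℕ.≤-reflexive (≡.sym (ℕ.+-suc ∣ p ∣ ∣ q ∣)))
∣p∪q∣≤∣p∣+∣q∣ (inside ∷ p)  (outside ∷ q) = ℕ.s≤s (∣p∪q∣≤∣p∣+∣q∣ p q)
∣p∪q∣≤∣p∣+∣q∣ (inside ∷ p)  (inside ∷ q)  =
  ℕ.s≤s (ℕ.≤-trans (∣p∪q∣≤∣p∣+∣q∣ p q) (ℕ.+-monoʳ-≤ ∣ p ∣ (ℕ.n≤1+n _)))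

∣p∪⁅x⁆∣≤1+∣p∣ : ∀ {n} (p : Subset n) x → ∣ p ∪ ⁅ x ⁆ ∣ ℕ.≤ ℕ.suc ∣ p ∣
∣p∪⁅x⁆∣≤1+∣p∣ p x = ℕ.≤-trans (∣p∪q∣≤∣p∣+∣q∣ p ⁅ x ⁆)
  (ℕ.≤-reflexive (≡.trans (≡.cong (∣ p ∣ ℕ.+_) (∣⁅x⁆∣≡1 x)) (ℕ.+-comm ∣ p ∣ 1)))

∣p∣<∣p∪⁅x⁆∣ : ∀ {n} {p : Subset n} {x} → x ∉ p → ∣ p ∣ ℕ.< ∣ p ∪ ⁅ x ⁆ ∣
∣p∣<∣p∪⁅x⁆∣ {x = x} x∉p =
  p⊂q⇒∣p∣<∣q∣ (p⊆p∪q _ , x , x∈p∪q⁺ (inj₂ (x∈⁅x⁆ x)) , x∉p)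

∈⇒∪⁅⁆≡ : ∀ {n} {p : Subset n} {x} → x ∈ p → p ∪ ⁅ x ⁆ ≡ p
∈⇒∪⁅⁆≡ x∈p = ⊆-antisym (p∪⁅x⁆⊆ (λ z → z) x∈p) (p⊆p∪q _)

-- Finite choice under double negation: it merges linear relations that are each only known not to
-- be absent into one simultaneous family.
¬¬-Fin-∀ : ∀ {n} {P : Fin n → Set} → (∀ i → ¬ ¬ P i) → ¬ ¬ (∀ i → P i)
¬¬-Fin-∀ {ℕ.zero}  ¬¬P ¬∀ = ¬∀ λ ()
¬¬-Fin-∀ {ℕ.suc n} ¬¬P ¬∀ = ¬¬P zero λ p₀ → ¬¬-Fin-∀ (¬¬P ∘ suc) λ ps →
  ¬∀ λ { zero → p₀ ; (suc i) → ps i }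

-- Linear independence and rank

module Independence (ℝ : Reals) where
  open Reals ℝ
  open LinearAlgebra ℝ
  open SemiringSum semiring
    using (sum; sum-cong-≋; sum-replicate-zero; ∑-distrib-+; ∑-comm; *-distribʳ-sum; *-distribˡ-sum)
  open RingProperties ring using (-‿distribˡ-*; -‿distribʳ-*)
  open SetoidReasoning setoid

  1≉0 : ¬ 1# ≈ 0#
  1≉0 1≈0 = IsStrictTotalOrder.irrefl isStrictTotalOrder (sym 1≈0) 0<1

  *-cancel-≈0 : ∀ {x y} → ¬ x ≈ 0# → x * y ≈ 0# → y ≈ 0#
  *-cancel-≈0 {x} {y} x≉0 xy≈0 with inverse x x≉0
  ... | z , xz≈1 = begin
    y            ≈⟨ *-identityˡ y ⟨
    1# * y       ≈⟨ *-congʳ (trans (sym xz≈1) (*-comm x z)) ⟩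
    (z * x) * y  ≈⟨ *-assoc z x y ⟩
    z * (x * y)  ≈⟨ *-congˡ xy≈0 ⟩
    z * 0#       ≈⟨ zeroʳ z ⟩
    0#           ∎

  sum-zero : ∀ {n} (f : Fin n → Carrier) → (∀ i → f i ≈ 0#) → sum f ≈ 0#
  sum-zero {n} f f≈0 = trans (sum-cong-≋ f≈0) (sum-replicate-zero n)

  unit : ∀ {n} → Fin n → Carrier → Fin n → Carrier
  unit q t i = if does (i Fin.≟ q) then t else 0#

  unit-≡ : ∀ {n} (q : Fin n) t → unit q t q ≡ t
  unit-≡ q t with q Fin.≟ q
  ... | yes _   = ≡.refl
  ... | no  q≢q = contradiction ≡.refl q≢q

  unit-≢ : ∀ {n} (q : Fin n) t {i} → i ≢ q → unit q t i ≡ 0#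
  unit-≢ q t {i} i≢q with i Fin.≟ q
  ... | yes i≡q = contradiction i≡q i≢q
  ... | no  _   = ≡.refl

  unit-suc : ∀ {n} (q i : Fin n) t → unit (suc q) t (suc i) ≡ unit q t i
  unit-suc q i t with i Fin.≟ q
  ... | yes _ = ≡.refl
  ... | no  _ = ≡.refl

  sum-unit : ∀ {n} (q : Fin n) t (v : Fin n → Carrier) → sum (λ i → unit q t i * v i) ≈ t * v q
  sum-unit zero t v = begin
    t * v zero + sum (λ i → 0# * v (suc i))  ≈⟨ +-congˡ (sum-zero _ (λ i → zeroˡ (v (suc i)))) ⟩
    t * v zero + 0#                          ≈⟨ +-identityʳ _ ⟩
    t * v zero                               ∎
  sum-unit (suc q) t v = begin
    0# * v zero + sum (λ i → unit (suc q) t (suc i) * v (suc i))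
      ≈⟨ +-cong (zeroˡ _) (sum-cong-≋ (λ i → *-congʳ (reflexive (unit-suc q i t)))) ⟩
    0# + sum (λ i → unit q t i * v (suc i))
      ≈⟨ +-identityˡ _ ⟩
    sum (λ i → unit q t i * v (suc i))
      ≈⟨ sum-unit q t (v ∘ suc) ⟩
    t * v (suc q) ∎

  sum-scale-unit : ∀ {n} s (c : Fin n → Carrier) q t (v : Fin n → Carrier) →
    sum (λ i → (s * c i + unit q t i) * v i) ≈ s * sum (λ i → c i * v i) + t * v q
  sum-scale-unit s c q t v = begin
    sum (λ i → (s * c i + unit q t i) * v i)
      ≈⟨ sum-cong-≋ (λ i → trans (distribʳ (v i) (s * c i) _) (+-congʳ (*-assoc s (c i) (v i)))) ⟩
    sum (λ i → s * (c i * v i) + unit q t i * v i)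
      ≈⟨ ∑-distrib-+ (λ i → s * (c i * v i)) _ ⟩
    sum (λ i → s * (c i * v i)) + sum (λ i → unit q t i * v i)
      ≈⟨ +-cong (sym (*-distribˡ-sum s (λ i → c i * v i))) (sum-unit q t v) ⟩
    s * sum (λ i → c i * v i) + t * v q ∎

  scale-unit-≢ : ∀ {n} s {x} (q : Fin n) t {i} → i ≢ q → s * x + unit q t i ≈ s * x
  scale-unit-≢ s q t i≢q = trans (+-congˡ (reflexive (unit-≢ q t i≢q))) (+-identityʳ _)

  Independent-⊆ : ∀ {p q} {A : Matrix ℝ p q} {T U} → U ⊆ T → Independent A T → Independent A U
  Independent-⊆ U⊆T ind c c∉U = ind c λ i i∉T → c∉U i (i∉T ∘ U⊆T)

  Independent-⊥ : ∀ {p q} {A : Matrix ℝ p q} → Independent A ⊥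
  Independent-⊥ c c∉⊥ _ i = c∉⊥ i ∉⊥

  noRows : ∀ {q} {A : Matrix ℝ 0 q} {T} → (¬ Nonempty T) ⇔ Independent A T
  noRows {A = A} {T} = mk⇔
    (λ T≡∅ c c∉T _ i → c∉T i (λ i∈T → T≡∅ (i , i∈T)))
    (λ { ind (q , q∈T) → 1≉0 (trans (reflexive (≡.sym (unit-≡ q 1#)))
      (ind (unit q 1#) (λ i i∉T → reflexive (unit-≢ q 1# {i} λ { ≡.refl → i∉T q∈T })) (λ ()) q)) })

  zeroRow : ∀ {p q} {A : Matrix ℝ (ℕ.suc p) q} {T} → (∀ i → i ∈ T → A zero i ≈ 0#) →
            Independent (A ∘ suc) T ⇔ Independent A T
  zeroRow {A = A} {T} row≈0 = mk⇔
    (λ ind c c∉T Ac≈0 → ind c c∉T (Ac≈0 ∘ suc))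
    (λ ind c c∉T Ac≈0 → ind c c∉T λ where
      zero    → sum-zero _ (term c c∉T)
      (suc a) → Ac≈0 a)
    where
    term : ∀ c → (∀ i → i ∉ T → c i ≈ 0#) → ∀ i → c i * A zero i ≈ 0#
    term c c∉T i with i ∈? T
    ... | no  i∉T = trans (*-congʳ (c∉T i i∉T)) (zeroˡ _)
    ... | yes i∈T = trans (*-congˡ (row≈0 i i∈T)) (zeroʳ _)

  -- Cross-multiplication avoids a division by the pivot.
  eliminate : ∀ {p n} → Matrix ℝ (ℕ.suc p) n → Fin n → Matrix ℝ p n
  eliminate A q a i = A zero q * A (suc a) i - A zero i * A (suc a) q

  module _ {p n} (A : Matrix ℝ (ℕ.suc p) n) (T : Subset n) (q : Fin n)
           (q∈T : q ∈ T) (pivot≉0 : ¬ A zero q ≈ 0#) where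

    private
      E : Matrix ℝ p n
      E = eliminate A q

      row : Fin (ℕ.suc p) → (Fin n → Carrier) → Carrier
      row a c = sum (λ i → c i * A a i)

      sum-E : ∀ c a → sum (λ i → c i * E a i) ≈
              A zero q * row (suc a) c + row zero c * - A (suc a) q
      sum-E c a = begin
        sum (λ i → c i * E a i)
          ≈⟨ sum-cong-≋ term ⟩
        sum (λ i → A zero q * (c i * A (suc a) i) + (c i * A zero i) * - A (suc a) q)
          ≈⟨ ∑-distrib-+ (λ i → A zero q * (c i * A (suc a) i)) _ ⟩
        sum (λ i → A zero q * (c i * A (suc a) i)) + sum (λ i → (c i * A zero i) * - A (suc a) q)
          ≈⟨ +-cong (*-distribˡ-sum (A zero q) (λ i → c i * A (suc a) i))
                    (*-distribʳ-sum (- A (suc a) q) (λ i → c i * A zero i)) ⟨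
        A zero q * row (suc a) c + row zero c * - A (suc a) q ∎
        where
        term : ∀ i → c i * E a i ≈ A zero q * (c i * A (suc a) i) + (c i * A zero i) * - A (suc a) q
        term i = begin
          c i * (A zero q * A (suc a) i + - (A zero i * A (suc a) q))
            ≈⟨ distribˡ _ _ _ ⟩
          c i * (A zero q * A (suc a) i) + c i * - (A zero i * A (suc a) q)
            ≈⟨ +-cong (trans (sym (*-assoc _ _ _)) (trans (*-congʳ (*-comm _ _)) (*-assoc _ _ _)))
                      (trans (*-congˡ (-‿distribʳ-* _ _)) (sym (*-assoc _ _ _))) ⟩
          A zero q * (c i * A (suc a) i) + (c i * A zero i) * - A (suc a) q ∎

      E-q : ∀ a → E a q ≈ 0#
      E-q a = -‿inverseʳ _

      module Clear (ind : Independent E (T ∖ q)) (c : Fin n → Carrier)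
                   (c∉T : ∀ i → i ∉ T → c i ≈ 0#) (Ac≈0 : ∀ a → row a c ≈ 0#) where

        -- Column `q` of `E` is zero, so erasing the coefficient at `q` leaves every combination of
        -- the columns of `E` unchanged.
        c′ : Fin n → Carrier
        c′ i = if does (i Fin.≟ q) then 0# else c i

        c′∉T′ : ∀ i → i ∉ T ∖ q → c′ i ≈ 0#
        c′∉T′ i i∉T′ with i Fin.≟ q
        ... | yes _   = refl
        ... | no  i≢q = c∉T i (λ i∈T → i∉T′ (x∈p∧x≢y⇒x∈p-y i∈T i≢q))

        term : ∀ a i → c′ i * E a i ≈ c i * E a i
        term a i with i Fin.≟ q
        ... | yes ≡.refl = trans (zeroˡ _) (sym (trans (*-congˡ (E-q a)) (zeroʳ _)))
        ... | no  i≢q    = refl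

        Ec′≈0 : ∀ a → sum (λ i → c′ i * E a i) ≈ 0#
        Ec′≈0 a = begin
          sum (λ i → c′ i * E a i)                               ≈⟨ sum-cong-≋ (term a) ⟩
          sum (λ i → c i * E a i)                                ≈⟨ sum-E c a ⟩
          A zero q * row (suc a) c + row zero c * - A (suc a) q  ≈⟨ +-cong (*-congˡ (Ac≈0 (suc a))) (*-congʳ (Ac≈0 zero)) ⟩
          A zero q * 0# + 0# * - A (suc a) q                     ≈⟨ +-cong (zeroʳ _) (zeroˡ _) ⟩
          0# + 0#                                                ≈⟨ +-identityʳ _ ⟩
          0#                                                     ∎

        others : ∀ i → i ≢ q → c i ≈ 0#
        others i i≢q with i Fin.≟ q | ind c′ c′∉T′ Ec′≈0 i
        ... | yes i≡q | _    = contradiction i≡q i≢q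
        ... | no  _   | ci≈0 = ci≈0
      from : Independent E (T ∖ q) → Independent A T
      from ind c c∉T Ac≈0 i with i Fin.≟ q
      ... | no  i≢q    = others i i≢q
        where open Clear ind c c∉T Ac≈0
      ... | yes ≡.refl = *-cancel-≈0 pivot≉0 (begin
          A zero q * c q                            ≈⟨ *-comm _ _ ⟩
          c q * A zero q                            ≈⟨ sum-unit q (c q) (A zero) ⟨
          sum (λ i → unit q (c q) i * A zero i)     ≈⟨ sum-cong-≋ (λ i → *-congʳ (unit≈c i)) ⟩
          row zero c                                ≈⟨ Ac≈0 zero ⟩
          0#                                        ∎)
        where
        open Clear ind c c∉T Ac≈0
        unit≈c : ∀ i → unit q (c q) i ≈ c i
        unit≈c i with i Fin.≟ q
        ... | yes ≡.refl = refl
        ... | no  i≢q    = sym (others i i≢q)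

      to : Independent A T → Independent E (T ∖ q)
      to ind c′ c′∉T′ Ec′≈0 i with i Fin.≟ q
      ... | yes ≡.refl = c′∉T′ q (q∉p∖q T q)
      ... | no  i≢q    = *-cancel-≈0 pivot≉0
                           (trans (sym (scale-unit-≢ _ q t i≢q)) (ind c c∉T Ac≈0 i))
        where
        -- A relation of `E` is lifted to `A` after scaling by the pivot, which replaces a division;
        -- the coefficient at `q` is then the one that cancels the first row.
        t = - row zero c′

        c : Fin n → Carrier
        c i = A zero q * c′ i + unit q t i

        c∉T : ∀ i → i ∉ T → c i ≈ 0#
        c∉T i i∉T = begin
          A zero q * c′ i + unit q t i  ≈⟨ scale-unit-≢ _ q t {i} (λ { ≡.refl → i∉T q∈T }) ⟩
          A zero q * c′ i               ≈⟨ *-congˡ (c′∉T′ i (i∉T ∘ p─q⊆p T _)) ⟩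
          A zero q * 0#                 ≈⟨ zeroʳ _ ⟩
          0#                            ∎

        Ac≈0 : ∀ a → row a c ≈ 0#
        Ac≈0 zero = begin
          row zero c                                         ≈⟨ sum-scale-unit _ c′ q t _ ⟩
          A zero q * row zero c′ + - row zero c′ * A zero q  ≈⟨ +-cong (*-comm _ _) (sym (-‿distribˡ-* _ _)) ⟩
          row zero c′ * A zero q - row zero c′ * A zero q    ≈⟨ -‿inverseʳ _ ⟩
          0#                                                 ∎
        Ac≈0 (suc a) = begin
          row (suc a) c
            ≈⟨ sum-scale-unit _ c′ q t _ ⟩
          A zero q * row (suc a) c′ + - row zero c′ * A (suc a) q
            ≈⟨ +-congˡ (trans (sym (-‿distribˡ-* _ _)) (-‿distribʳ-* _ _)) ⟩
          A zero q * row (suc a) c′ + row zero c′ * - A (suc a) q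
            ≈⟨ sum-E c′ a ⟨
          sum (λ i → c′ i * E a i)
            ≈⟨ Ec′≈0 a ⟩
          0# ∎

    pivotRow : Independent E (T ∖ q) ⇔ Independent A T
    pivotRow = mk⇔ from to

  module _ {p n} (A : Matrix ℝ p n) where

    InSpan : Subset n → Fin n → Set
    InSpan T e = ∃ λ (c : Fin n → Carrier) → (∀ i → i ∉ T → c i ≈ 0#) × (∀ a → sum (λ i → c i * A a i) ≈ A a e)

    ∈⇒InSpan : ∀ {T e} → e ∈ T → InSpan T e
    ∈⇒InSpan {e = e} e∈T =
      unit e 1# ,
      (λ i i∉T → reflexive (unit-≢ e 1# {i} λ { ≡.refl → i∉T e∈T })) ,
      λ a → trans (sum-unit e 1# (A a)) (*-identityˡ _)

    InSpan-⊆ : ∀ {T U e} → T ⊆ U → InSpan T e → InSpan U e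
    InSpan-⊆ T⊆U (c , c∉T , Ac≈e) = c , (λ i i∉U → c∉T i (i∉U ∘ T⊆U)) , Ac≈e

    -- A relation with a nonzero coefficient at `e` can be solved for column `e`; one with
    -- coefficient zero is already a relation on `T`.
    ¬InSpan⇒Independent : ∀ {T e} → Independent A T → ¬ InSpan T e → Independent A (T ∪ ⁅ e ⁆)
    ¬InSpan⇒Independent {T} {e} ind e∉span c c∉ Ac≈0 with c e ≟ 0#
    ... | yes ce≈0 = ind c c∉T Ac≈0
      where
      c∉T : ∀ i → i ∉ T → c i ≈ 0#
      c∉T i i∉T with i Fin.≟ e
      ... | yes ≡.refl = ce≈0
      ... | no  i≢e    = c∉ i ([ i∉T , i≢e ∘ x∈⁅y⁆⇒x≡y e ]′ ∘ x∈p∪q⁻ T ⁅ e ⁆)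
    ... | no  ce≉0 with inverse (c e) ce≉0
    ...   | z , ce*z≈1 = contradiction (d , d∉T , Ad≈e) e∉span
      where
      d : Fin n → Carrier
      d i = - z * c i + unit e 1# i

      d∉T : ∀ i → i ∉ T → d i ≈ 0#
      d∉T i i∉T with i Fin.≟ e
      ... | yes ≡.refl = begin
        - z * c e + 1#       ≈⟨ +-congʳ (sym (-‿distribˡ-* _ _)) ⟩
        - (z * c e) + 1#     ≈⟨ +-congʳ (-‿cong (trans (*-comm _ _) ce*z≈1)) ⟩
        - 1# + 1#            ≈⟨ -‿inverseˡ _ ⟩
        0#                   ∎
      ... | no  i≢e    = begin
        - z * c i + 0#       ≈⟨ +-identityʳ _ ⟩
        - z * c i            ≈⟨ *-congˡ (c∉ i ([ i∉T , i≢e ∘ x∈⁅y⁆⇒x≡y e ]′ ∘ x∈p∪q⁻ T ⁅ e ⁆)) ⟩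
        - z * 0#             ≈⟨ zeroʳ _ ⟩
        0#                   ∎

      Ad≈e : ∀ a → sum (λ i → d i * A a i) ≈ A a e
      Ad≈e a = begin
        sum (λ i → d i * A a i)                     ≈⟨ sum-scale-unit (- z) c e 1# (A a) ⟩
        - z * sum (λ i → c i * A a i) + 1# * A a e  ≈⟨ +-cong (trans (*-congˡ (Ac≈0 a)) (zeroʳ _)) (*-identityˡ _) ⟩
        0# + A a e                                  ≈⟨ +-identityˡ _ ⟩
        A a e                                       ∎

    InSpan⇒¬Independent : ∀ {T e} → e ∈ T → InSpan (T ∖ e) e → ¬ Independent A T
    InSpan⇒¬Independent {T} {e} e∈T (c , c∉T′ , Ac≈e) ind = 1≉0 (begin
        1#                       ≈⟨ +-identityˡ _ ⟨
        0# + 1#                  ≈⟨ +-cong (trans (*-congˡ (c∉T′ e (q∉p∖q T e))) (zeroʳ _)) (reflexive (unit-≡ e 1#)) ⟨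
        d e                      ≈⟨ ind d d∉T Ad≈0 e ⟩
        0#                       ∎)
      where
      d : Fin n → Carrier
      d i = - 1# * c i + unit e 1# i

      d∉T : ∀ i → i ∉ T → d i ≈ 0#
      d∉T i i∉T = begin
        d i         ≈⟨ scale-unit-≢ (- 1#) e 1# {i} (λ { ≡.refl → i∉T e∈T }) ⟩
        - 1# * c i  ≈⟨ *-congˡ (c∉T′ i (i∉T ∘ p─q⊆p T _)) ⟩
        - 1# * 0#   ≈⟨ zeroʳ _ ⟩
        0#          ∎

      Ad≈0 : ∀ a → sum (λ i → d i * A a i) ≈ 0#
      Ad≈0 a = begin
        sum (λ i → d i * A a i)                        ≈⟨ sum-scale-unit (- 1#) c e 1# (A a) ⟩
        - 1# * sum (λ i → c i * A a i) + 1# * A a e    ≈⟨ +-congʳ (*-congˡ (Ac≈e a)) ⟩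
        - 1# * A a e + 1# * A a e                      ≈⟨ distribʳ _ _ _ ⟨
        (- 1# + 1#) * A a e                            ≈⟨ *-congʳ (-‿inverseˡ _) ⟩
        0# * A a e                                     ≈⟨ zeroˡ _ ⟩
        0#                                             ∎

    -- Double negations, because the failure of independence does not come with
    -- a linear relation.
    InSpan-trans : ∀ {T X e} → (∀ x → x ∈ X → ¬ ¬ InSpan T x) → InSpan X e → ¬ ¬ InSpan T e
    InSpan-trans {T} {X} {e} X⊆span (c , c∉X , Ac≈e) ¬goal = ¬¬-Fin-∀ expand λ D →
      ¬goal ((λ t → sum (λ x → c x * proj₁ (D x) t)) , supp D , expanded D)
      where
      -- Both sides carry the factor `c x`, so that an index outside `X`, where `c x` vanishes,
      -- admits the zero expansion and the choice can range over all indices.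
      Expansion : Fin n → Set
      Expansion x = ∃ λ (d : Fin n → Carrier) → (∀ i → i ∉ T → d i ≈ 0#) ×
                            (∀ a → c x * sum (λ i → d i * A a i) ≈ c x * A a x)

      expand : ∀ x → ¬ ¬ Expansion x
      expand x ¬D with x ∈? X
      ... | yes x∈X = X⊆span x x∈X λ (d , d∉T , Ad≈x) → ¬D (d , d∉T , λ a → *-congˡ (Ad≈x a))
      ... | no  x∉X = ¬D ((λ _ → 0#) , (λ _ _ → refl) , λ a →
        trans (*-congʳ (c∉X x x∉X)) (trans (zeroˡ _) (sym (trans (*-congʳ (c∉X x x∉X)) (zeroˡ _)))))

      supp : (D : ∀ x → Expansion x) → ∀ t → t ∉ T → sum (λ x → c x * proj₁ (D x) t) ≈ 0#
      supp D t t∉T = sum-zero _ λ x → trans (*-congˡ (proj₁ (proj₂ (D x)) t t∉T)) (zeroʳ _)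

      expanded : (D : ∀ x → Expansion x) → ∀ a →
                 sum (λ t → sum (λ x → c x * proj₁ (D x) t) * A a t) ≈ A a e
      expanded D a = begin
        sum (λ t → sum (λ x → c x * proj₁ (D x) t) * A a t)
          ≈⟨ sum-cong-≋ (λ t → *-distribʳ-sum (A a t) (λ x → c x * proj₁ (D x) t)) ⟩
        sum (λ t → sum (λ x → c x * proj₁ (D x) t * A a t))
          ≈⟨ ∑-comm (λ t x → c x * proj₁ (D x) t * A a t) ⟩
        sum (λ x → sum (λ t → c x * proj₁ (D x) t * A a t))
          ≈⟨ sum-cong-≋ (λ x → trans (sum-cong-≋ (λ t → *-assoc (c x) (proj₁ (D x) t) (A a t)))
                                     (sym (*-distribˡ-sum (c x) (λ t → proj₁ (D x) t * A a t)))) ⟩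
        sum (λ x → c x * sum (λ t → proj₁ (D x) t * A a t))
          ≈⟨ sum-cong-≋ (λ x → proj₂ (proj₂ (D x)) a) ⟩
        sum (λ x → c x * A a x)
          ≈⟨ Ac≈e a ⟩
        A a e ∎

-- The rank as a matroid rank function

module Rank (ℝ : Reals) where
  open LinearAlgebra ℝ
  open Independence ℝ
  open ℕ.≤-Reasoning

  module _ {p n} (A : Matrix ℝ p n) where

    basis : ∀ S → ∃ λ T → T ⊆ S × Independent A T × ∣ T ∣ ≡ rank A S
    basis S = proj₁ (proj₂ (rank-exists A S))

    ∣independent∣≤rank : ∀ {S T} → T ⊆ S → Independent A T → ∣ T ∣ ℕ.≤ rank A S
    ∣independent∣≤rank {S} {T} = proj₂ (proj₂ (rank-exists A S)) T

    rank-⊆ : ∀ {X Y} → X ⊆ Y → rank A X ℕ.≤ rank A Y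
    rank-⊆ {X} X⊆Y with basis X
    ... | T , T⊆X , ind , ∣T∣≡ = ≡.subst (ℕ._≤ _) ∣T∣≡ (∣independent∣≤rank (X⊆Y ∘ T⊆X) ind)

    rank-⊥ : rank A ⊥ ≡ 0
    rank-⊥ with basis ⊥
    ... | T , T⊆⊥ , ind , ∣T∣≡ = ≡.trans (≡.sym ∣T∣≡) (ℕ.n≤0⇒n≡0
      (ℕ.≤-trans (p⊆q⇒∣p∣≤∣q∣ T⊆⊥) (ℕ.≤-reflexive (∣⊥∣≡0 n))))

    private
      ∖-⊆ : ∀ {X U : Subset n} {e} → U ⊆ X ∪ ⁅ e ⁆ → U ∖ e ⊆ X
      ∖-⊆ {X} {U} {e} U⊆ {y} y∈ with x∈p∪q⁻ X ⁅ e ⁆ (U⊆ (p─q⊆p U _ y∈))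
      ... | inj₁ y∈X = y∈X
      ... | inj₂ y∈e = contradiction (≡.subst (_∈ _) (x∈⁅y⁆⇒x≡y e y∈e) y∈) (q∉p∖q U e)

      ∣U∣≤1+∣U∖e∣ : ∀ (U : Subset n) e → ∣ U ∣ ℕ.≤ ℕ.suc ∣ U ∖ e ∣
      ∣U∣≤1+∣U∖e∣ U e = ℕ.≤-trans (p⊆q⇒∣p∣≤∣q∣ (p⊆p∖x∪⁅x⁆ U e)) (∣p∪⁅x⁆∣≤1+∣p∣ (U ∖ e) e)

    rank-∪⁅⁆≤ : ∀ X e → rank A (X ∪ ⁅ e ⁆) ℕ.≤ ℕ.suc (rank A X)
    rank-∪⁅⁆≤ X e with basis (X ∪ ⁅ e ⁆)
    ... | U , U⊆ , ind , ∣U∣≡ = ≡.subst (ℕ._≤ _) ∣U∣≡ (ℕ.≤-trans (∣U∣≤1+∣U∖e∣ U e)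
      (ℕ.s≤s (∣independent∣≤rank (∖-⊆ U⊆) (Independent-⊆ (p─q⊆p U _) ind))))

    -- If e raised the rank of X, and U were a basis of X ∪ ⁅ e ⁆, then U ∖ e would
    -- be independent of maximal size in X, and so would span X and with it e.
    dependent⇒rank≤ : ∀ {T X e} → T ⊆ X → Independent A T → ¬ Independent A (T ∪ ⁅ e ⁆) →
                      rank A (X ∪ ⁅ e ⁆) ℕ.≤ rank A X
    dependent⇒rank≤ {T} {X} {e} T⊆X ind dep with basis (X ∪ ⁅ e ⁆)
    ... | U , U⊆ , indU , ∣U∣≡ = ℕ.≮⇒≥ λ rk< →
        let rk<∣U∣ = ≡.subst (rank A X ℕ.<_) (≡.sym ∣U∣≡) rk< in
        e∈span λ e∈spanX → InSpan-trans A (X⊆span rk<∣U∣) e∈spanX λ e∈spanU′ →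
          InSpan⇒¬Independent A (e∈U rk<∣U∣) e∈spanU′ indU
      where
      e∈span : ¬ ¬ InSpan A X e
      e∈span ¬sp = dep (¬InSpan⇒Independent A ind (¬sp ∘ InSpan-⊆ A T⊆X))

      indU′ : Independent A (U ∖ e)
      indU′ = Independent-⊆ (p─q⊆p U _) indU

      X⊆span : rank A X ℕ.< ∣ U ∣ → ∀ x → x ∈ X → ¬ ¬ InSpan A (U ∖ e) x
      X⊆span rk< x x∈X ¬sp = ℕ.<-irrefl ≡.refl (begin-strict
          rank A X                ≤⟨ ℕ.≤-pred (ℕ.≤-trans rk< (∣U∣≤1+∣U∖e∣ U e)) ⟩
          ∣ U ∖ e ∣               <⟨ ∣p∣<∣p∪⁅x⁆∣ (¬sp ∘ ∈⇒InSpan A) ⟩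
          ∣ (U ∖ e) ∪ ⁅ x ⁆ ∣     ≤⟨ ∣independent∣≤rank (p∪⁅x⁆⊆ (∖-⊆ U⊆) x∈X) (¬InSpan⇒Independent A indU′ ¬sp) ⟩
          rank A X                ∎)

      e∈U : rank A X ℕ.< ∣ U ∣ → e ∈ U
      -- Without `e`, the set `U` would be an independent subset of `X` larger than the rank of `X`.
      e∈U rk< = decidable-stable (e ∈? U) λ e∉U → ℕ.<⇒≱ rk<
        (∣independent∣≤rank (λ y∈U → ∖-⊆ U⊆ (x∈p∧x≢y⇒x∈p-y y∈U λ { ≡.refl → e∉U y∈U })) indU)

    -- A basis of Y either is extended by e, or has e in its span, and then so does X.
    rank-submodular : ∀ {X Y} e → Y ⊆ X →
      rank A (X ∪ ⁅ e ⁆) ℕ.+ rank A Y ℕ.≤ rank A (Y ∪ ⁅ e ⁆) ℕ.+ rank A X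
    rank-submodular {X} {Y} e Y⊆X with e ∈? Y
    ... | yes e∈Y = ℕ.≤-reflexive (≡.trans
        (≡.cong₂ (λ X Y → rank A X ℕ.+ rank A Y) (∈⇒∪⁅⁆≡ (Y⊆X e∈Y)) (≡.sym (∈⇒∪⁅⁆≡ e∈Y)))
        (ℕ.+-comm (rank A X) (rank A (Y ∪ ⁅ e ⁆))))
    ... | no  e∉Y with basis Y
    ... | B , B⊆Y , ind , ∣B∣≡ with independent? A (B ∪ ⁅ e ⁆)
    ...   | yes ind′ = begin
        rank A (X ∪ ⁅ e ⁆) ℕ.+ rank A Y  ≤⟨ ℕ.+-monoˡ-≤ (rank A Y) (rank-∪⁅⁆≤ X e) ⟩
        ℕ.suc (rank A X ℕ.+ rank A Y)    ≡⟨ ≡.cong ℕ.suc (ℕ.+-comm (rank A X) (rank A Y)) ⟩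
        ℕ.suc (rank A Y) ℕ.+ rank A X    ≤⟨ ℕ.+-monoˡ-≤ (rank A X) 1+rkY≤ ⟩
        rank A (Y ∪ ⁅ e ⁆) ℕ.+ rank A X  ∎
        where
        1+rkY≤ : ℕ.suc (rank A Y) ℕ.≤ rank A (Y ∪ ⁅ e ⁆)
        1+rkY≤ = begin
          ℕ.suc (rank A Y)    ≡⟨ ≡.cong ℕ.suc ∣B∣≡ ⟨
          ℕ.suc ∣ B ∣         ≤⟨ ∣p∣<∣p∪⁅x⁆∣ (e∉Y ∘ B⊆Y) ⟩
          ∣ B ∪ ⁅ e ⁆ ∣       ≤⟨ ∣independent∣≤rank (∪⁅⁆-monoˡ e B⊆Y) ind′ ⟩
          rank A (Y ∪ ⁅ e ⁆)  ∎
    ...   | no  dep  = begin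
        rank A (X ∪ ⁅ e ⁆) ℕ.+ rank A Y  ≡⟨ ℕ.+-comm (rank A (X ∪ ⁅ e ⁆)) (rank A Y) ⟩
        rank A Y ℕ.+ rank A (X ∪ ⁅ e ⁆)  ≤⟨ ℕ.+-mono-≤ (rank-⊆ (p⊆p∪q ⁅ e ⁆)) (dependent⇒rank≤ (Y⊆X ∘ B⊆Y) ind dep) ⟩
        rank A (Y ∪ ⁅ e ⁆) ℕ.+ rank A X  ∎

-- Query programs

open ≡ using (refl; sym; trans; cong; cong₂; subst)

-- The free monad on one query operation, i.e. an adaptive decision tree. It separates counting
-- queries from answering them: values of the function are implemented by ranks, ranks by
-- independence tests, and the counts multiply.
data Program (Q R A : Set) : Set where
  return : A → Program Q R A
  ask    : Q → (R → Program Q R A) → Program Q R A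

module _ {Q R A : Set} (oracle : Q → R) where

  eval : Program Q R A → A
  eval (return a) = a
  eval (ask q k)  = eval (k (oracle q))

  cost : Program Q R A → ℕ
  cost (return a) = 0
  cost (ask q k)  = ℕ.suc (cost (k (oracle q)))

module _ {Q R : Set} where

  infixl 1 _>>=_
  _>>=_ : ∀ {A B} → Program Q R A → (A → Program Q R B) → Program Q R B
  return a >>= f = f a
  ask q k  >>= f = ask q λ v → k v >>= f

  module _ (oracle : Q → R) {A B : Set} (f : A → Program Q R B) where

    eval->>= : ∀ P → eval oracle (P >>= f) ≡ eval oracle (f (eval oracle P))
    eval->>= (return a) = refl
    eval->>= (ask q k)  = eval->>= (k (oracle q))

    cost->>= : ∀ P → cost oracle (P >>= f) ≡ cost oracle P ℕ.+ cost oracle (f (eval oracle P))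
    cost->>= (return a) = refl
    cost->>= (ask q k)  = cong ℕ.suc (cost->>= (k (oracle q)))

module _ {Q R Q′ R′ : Set} (h : Q → Program Q′ R′ R) where

  implement : ∀ {A} → Program Q R A → Program Q′ R′ A
  implement (return a) = return a
  implement (ask q k)  = h q >>= λ v → implement (k v)

  module _ {oracle : Q → R} {oracle′ : Q′ → R′} (h-correct : ∀ q → eval oracle′ (h q) ≡ oracle q) where

    eval-implement : ∀ {A} (P : Program Q R A) → eval oracle′ (implement P) ≡ eval oracle P
    eval-implement (return a) = refl
    eval-implement (ask q k)  = trans (eval->>= oracle′ _ (h q))
      (trans (cong (eval oracle′ ∘ implement ∘ k) (h-correct q)) (eval-implement (k (oracle q))))

    cost-implement : ∀ {c} → (∀ q → cost oracle′ (h q) ℕ.≤ c) → ∀ {A} (P : Program Q R A) →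
                     cost oracle′ (implement P) ℕ.≤ cost oracle P ℕ.* c
    cost-implement h≤c (return a) = ℕ.z≤n
    cost-implement {c} h≤c (ask q k) = begin
      cost oracle′ (h q >>= (implement ∘ k))
        ≡⟨ cost->>= oracle′ _ (h q) ⟩
      cost oracle′ (h q) ℕ.+ cost oracle′ (implement (k (eval oracle′ (h q))))
        ≡⟨ cong (λ v → cost oracle′ (h q) ℕ.+ cost oracle′ (implement (k v))) (h-correct q) ⟩
      cost oracle′ (h q) ℕ.+ cost oracle′ (implement (k (oracle q)))
        ≤⟨ ℕ.+-mono-≤ (h≤c q) (cost-implement h≤c (k (oracle q))) ⟩
      c ℕ.+ cost oracle (k (oracle q)) ℕ.* c ∎
      where open ℕ.≤-Reasoning

-- Minimising a submodular function

square : ℤ → ℤ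
square x = x ℤ.* x

0≤square : ∀ x → 0ℤ ℤ.≤ square x
0≤square (ℤ.+ n)     = subst (0ℤ ℤ.≤_) (ℤ.pos-* n n) (+≤+ ℕ.z≤n)
0≤square ℤ.-[1+ n ]  = +≤+ ℕ.z≤n

square-mono : ∀ {x y} → 0ℤ ℤ.≤ x → x ℤ.≤ y → square x ℤ.≤ square y
square-mono {x} {y} 0≤x x≤y = ℤ.≤-trans
  (ℤ.*-monoˡ-≤-nonNeg x {{ℤ.nonNegative 0≤x}} x≤y)
  (ℤ.*-monoʳ-≤-nonNeg y {{ℤ.nonNegative (ℤ.≤-trans 0≤x x≤y)}} x≤y)

descending : ℕ → DecTotalOrder 0ℓ 0ℓ 0ℓ
descending r = On.decTotalOrder (Flip.decTotalOrder ℤ.≤-decTotalOrder) (proj₂ {A = Fin r} {B = λ _ → ℤ})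

∈⇒∩-∪⁅⁆ : ∀ {n} {S : Subset n} {e} X → e ∈ S → S ∩ (X ∪ ⁅ e ⁆) ≡ (S ∩ X) ∪ ⁅ e ⁆
∈⇒∩-∪⁅⁆ {S = S} {e} X e∈S = trans (∩-distribˡ-∪ S X ⁅ e ⁆) (cong ((S ∩ X) ∪_)
  (⊆-antisym (p∩q⊆q S ⁅ e ⁆) λ {x} x∈ → x∈p∩q⁺ (subst (_∈ S) (sym (x∈⁅y⁆⇒x≡y e x∈)) e∈S , x∈)))

∉⇒∩-∪⁅⁆ : ∀ {n} {S : Subset n} {e} X → e ∉ S → S ∩ (X ∪ ⁅ e ⁆) ≡ S ∩ X
∉⇒∩-∪⁅⁆ {S = S} {e} X e∉S = ⊆-antisym
  (λ {x} x∈ → let (x∈S , x∈X∪e) = x∈p∩q⁻ S _ x∈ in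
    Sum.[ (λ x∈X → x∈p∩q⁺ (x∈S , x∈X))
        , (λ x∈e → contradiction (subst (_∈ S) (x∈⁅y⁆⇒x≡y e x∈e) x∈S) e∉S) ]′
      (x∈p∪q⁻ X ⁅ e ⁆ x∈X∪e))
  (λ {x} x∈ → let (x∈S , x∈X) = x∈p∩q⁻ S X x∈ in x∈p∩q⁺ (x∈S , p⊆p∪q ⁅ e ⁆ x∈X))

module Descent (r N : ℕ) where

  open import Data.Integer.Base using (+_)

  open Sort (descending r) using (sort; sort-↭; sort-↗)

  State : Set
  State = List (Fin r × ℤ)

  Search : Set
  Search = Program (Subset r) ℤ Bool

  clip : ℤ → ℤ
  clip x with x ℤ.≤? 0ℤ | x ℤ.≤? + N
  ... | yes _ | _     = 0ℤ
  ... | no  _ | yes _ = x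
  ... | no  _ | no  _ = + N

  -- One descent step.  X grows along a chain, at which the function has the value v.
  -- When the state lists its values in descending order, the increments along the
  -- chain form a subgradient of the Lovász extension.
  sweep : Subset r → ℤ → State → (State → Search) → Search
  sweep X v []            k = k []
  sweep X v ((e , y) ∷ L) k = ask (X ∪ ⁅ e ⁆) λ v′ →
    if does (v′ ℤ.<? 0ℤ) then return false else
    sweep (X ∪ ⁅ e ⁆) v′ L λ L′ → k ((e , clip (y ℤ.- (v′ ℤ.- v))) ∷ L′)

  rounds : ℕ → Subset r → ℤ → State → Search → Search
  rounds ℕ.zero    X v L next = next
  rounds (ℕ.suc T) X v L next = sweep X v (sort L) λ L′ → rounds T X v L′ next

  initial : State
  initial = List.map (_, 0ℤ) (allFin r)

  searchAbove : ℕ → Subset r → Search → Search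
  searchAbove T X next = ask X λ v →
    if does (v ℤ.<? 0ℤ) then return false else rounds T X v initial next

  search : ℕ → List (Subset r) → Search
  search T []       = return true
  search T (X ∷ Xs) = searchAbove T X (search T Xs)

  elements : State → List (Fin r)
  elements = List.map proj₁

  InBox : State → Set
  InBox = All λ (_ , y) → 0ℤ ℤ.≤ y × y ℤ.≤ + N

  elements-initial : elements initial ≡ allFin r
  elements-initial = trans (sym (List.map-∘ (allFin r))) (List.map-id (allFin r))

  initial-InBox : InBox initial
  initial-InBox = All.map⁺ (All.universal (λ _ → ℤ.≤-refl , +≤+ ℕ.z≤n) (allFin r))

  clip-InBox : ∀ x → 0ℤ ℤ.≤ clip x × clip x ℤ.≤ + N
  clip-InBox x with x ℤ.≤? 0ℤ | x ℤ.≤? + N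
  ... | yes _  | _       = ℤ.≤-refl , +≤+ ℕ.z≤n
  ... | no x≰0 | yes x≤N = ℤ.<⇒≤ (ℤ.≰⇒> x≰0) , x≤N
  ... | no _   | no _    = +≤+ ℕ.z≤n , ℤ.≤-refl

  square-neg : ∀ x y → square (x ℤ.- y) ≡ square (y ℤ.- x)
  square-neg x y = lemma x y
    where
    lemma : ∀ x y → (x ℤ.- y) ℤ.* (x ℤ.- y) ≡ (y ℤ.- x) ℤ.* (y ℤ.- x)
    lemma = solve-∀

  -- Projection onto an interval does not increase the distance to a point of that interval.
  clip-contracts : ∀ x {z} → 0ℤ ℤ.≤ z → z ℤ.≤ + N → square (clip x ℤ.- z) ℤ.≤ square (x ℤ.- z)
  clip-contracts x {z} 0≤z z≤N with x ℤ.≤? 0ℤ | x ℤ.≤? + N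
  -- Both differences are reversed, because `square-mono` wants them nonnegative.
  ... | yes x≤0 | _       = subst₂≤ (square-neg z 0ℤ) (square-neg z x)
        (square-mono (ℤ.i≤j⇒0≤j-i 0≤z) (ℤ.+-monoʳ-≤ z (ℤ.neg-mono-≤ x≤0)))
        where subst₂≤ = ≡.subst₂ ℤ._≤_
  ... | no  _   | yes _   = ℤ.≤-refl
  ... | no  _   | no  x≰N =
        square-mono (ℤ.i≤j⇒0≤j-i z≤N) (ℤ.+-monoˡ-≤ (ℤ.- z) (ℤ.<⇒≤ (ℤ.≰⇒> x≰N)))

  module Soundness (F : Subset r → ℤ) (nonNeg : ∀ X → 2 ℕ.≤ ∣ X ∣ → 0ℤ ℤ.≤ F X) where

    sweep-true : ∀ {X v} L {k} → 2 ℕ.≤ ∣ X ∣ → (∀ L′ → eval F (k L′) ≡ true) →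
                 eval F (sweep X v L k) ≡ true
    sweep-true []            2≤ k-true = k-true []
    sweep-true {X} ((e , y) ∷ L) 2≤ k-true with F (X ∪ ⁅ e ⁆) ℤ.<? 0ℤ
    ... | yes F<0 = contradiction (nonNeg _ (ℕ.≤-trans 2≤ (∣p∣≤∣p∪q∣ X ⁅ e ⁆))) (ℤ.<⇒≱ F<0)
    ... | no  _   = sweep-true L (ℕ.≤-trans 2≤ (∣p∣≤∣p∪q∣ X ⁅ e ⁆)) (λ L′ → k-true _)

    rounds-true : ∀ T {X v} L {next} → 2 ℕ.≤ ∣ X ∣ → eval F next ≡ true →
                  eval F (rounds T X v L next) ≡ true
    rounds-true ℕ.zero    L 2≤ next-true = next-true
    rounds-true (ℕ.suc T) L 2≤ next-true =
      sweep-true (sort L) 2≤ λ L′ → rounds-true T L′ 2≤ next-true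

    search-true : ∀ T {Xs} → All (λ X → 2 ℕ.≤ ∣ X ∣) Xs → eval F (search T Xs) ≡ true
    search-true T []                 = refl
    search-true T (_∷_ {X} 2≤ 2≤s) with F X ℤ.<? 0ℤ
    ... | yes F<0 = contradiction (nonNeg X 2≤) (ℤ.<⇒≱ F<0)
    ... | no  _   = rounds-true T initial 2≤ (search-true T 2≤s)

  module Cost (F : Subset r → ℤ) where

    cost-sweep : ∀ {X v} L {k c} → (∀ L′ → elements L′ ≡ elements L → cost F (k L′) ℕ.≤ c) →
                 cost F (sweep X v L k) ℕ.≤ length L ℕ.+ c
    cost-sweep []            k≤c = k≤c [] refl
    cost-sweep {X} ((e , y) ∷ L) k≤c with F (X ∪ ⁅ e ⁆) ℤ.<? 0ℤ
    ... | yes _ = ℕ.s≤s ℕ.z≤n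
    ... | no  _ = ℕ.s≤s (cost-sweep L λ L′ eq → k≤c _ (cong (e ∷_) eq))

    cost-rounds : ∀ T {X v} L {next} → length L ≡ r →
                  cost F (rounds T X v L next) ℕ.≤ T ℕ.* r ℕ.+ cost F next
    cost-rounds ℕ.zero    L         ∣L∣ = ℕ.≤-refl
    cost-rounds (ℕ.suc T) L {next} ∣L∣ = ℕ.≤-trans
      (cost-sweep (sort L) λ L′ eq → cost-rounds T L′ (trans (sym (List.length-map proj₁ L′))
        (trans (cong length eq) (trans (List.length-map proj₁ (sort L)) ∣sortL∣))))
      (ℕ.≤-reflexive (trans (cong (ℕ._+ (T ℕ.* r ℕ.+ cost F next)) ∣sortL∣)
        (sym (ℕ.+-assoc r (T ℕ.* r) (cost F next)))))
      where
      ∣sortL∣ : length (sort L) ≡ r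
      ∣sortL∣ = trans (↭-length (sort-↭ L)) ∣L∣

    cost-search : ∀ T Xs → cost F (search T Xs) ℕ.≤ length Xs ℕ.* (1 ℕ.+ T ℕ.* r)
    cost-search T []       = ℕ.z≤n
    cost-search T (X ∷ Xs) with F X ℤ.<? 0ℤ
    ... | yes _ = ℕ.s≤s ℕ.z≤n
    ... | no  _ = ℕ.s≤s (ℕ.≤-trans (cost-rounds T initial
        (trans (List.length-map (_, 0ℤ) (allFin r)) (List.length-tabulate (λ i → i))))
        (ℕ.+-monoʳ-≤ (T ℕ.* r) (cost-search T Xs)))

  -- Convergence of the descent when a violating set exists

  module Completeness
    (F : Subset r → ℤ)
    (submodular : ∀ {X Y} e → Y ⊆ X → (e ∈ X → e ∈ Y) →
                  F (X ∪ ⁅ e ⁆) ℤ.- F X ℤ.≤ F (Y ∪ ⁅ e ⁆) ℤ.- F Y)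
    (M : ℕ) (increment² : ∀ X e → square (F (X ∪ ⁅ e ⁆) ℤ.- F X) ℤ.≤ + M)
    (N≡ : N ≡ 1 ℕ.+ r ℕ.* M)
    (S : Subset r) (FS<0 : F S ℤ.< 0ℤ)
    where

    χ : Fin r → ℤ
    χ e = if does (e ∈? S) then + N else 0ℤ

    χ-InBox : ∀ e → 0ℤ ℤ.≤ χ e × χ e ℤ.≤ + N
    χ-InBox e with e ∈? S
    ... | yes _ = +≤+ ℕ.z≤n , ℤ.≤-refl
    ... | no  _ = ℤ.≤-refl , +≤+ ℕ.z≤n

    -- The squared Euclidean distance from the state to `N` times the indicator vector of `S`.
    Φ : State → ℤ
    Φ []            = 0ℤ
    Φ ((e , y) ∷ L) = square (y ℤ.- χ e) ℤ.+ Φ L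

    0≤Φ : ∀ L → 0ℤ ℤ.≤ Φ L
    0≤Φ []            = ℤ.≤-refl
    0≤Φ ((e , y) ∷ L) = ℤ.+-mono-≤ (0≤square (y ℤ.- χ e)) (0≤Φ L)

    Φ-↭ : ∀ {L L′} → L ↭ L′ → Φ L ≡ Φ L′
    Φ-↭ Perm.refl         = refl
    Φ-↭ (Perm.prep x p)   = cong (λ z → square (proj₂ x ℤ.- χ (proj₁ x)) ℤ.+ z) (Φ-↭ p)
    Φ-↭ (Perm.swap {L} {L′} (e , y) (e′ , y′) p) = trans
      (cong (λ z → square (y ℤ.- χ e) ℤ.+ (square (y′ ℤ.- χ e′) ℤ.+ z)) (Φ-↭ p))
      (exchange (square (y ℤ.- χ e)) (square (y′ ℤ.- χ e′)) (Φ L′))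
      where
      exchange : ∀ a b c → a ℤ.+ (b ℤ.+ c) ≡ b ℤ.+ (a ℤ.+ c)
      exchange = solve-∀
    Φ-↭ (Perm.trans p q)  = trans (Φ-↭ p) (Φ-↭ q)

    2N : ℤ
    2N = + 2 ℤ.* + N

    -- A bound for the potential left by a sweep that has reached X, when L is still to
    -- come and its values are at most u.
    bound : Subset r → ℤ → State → ℤ
    bound X u L = Φ L ℤ.+ + length L ℤ.* + M ℤ.+ + 2 ℤ.* (u ℤ.* F X) ℤ.+ 2N ℤ.* (F S ℤ.- F (S ∩ X))

    -- The subgradient inequality at the target, one increment at a time. For `e` in `S`,
    -- diminishing returns allow `X` to be replaced by the smaller set `S ∩ X`; for `e` outside `S`
    -- both sides vanish. Along the chain the right-hand sides telescope.
    χ-increment : ∀ X e →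
      χ e ℤ.* (F (X ∪ ⁅ e ⁆) ℤ.- F X) ℤ.≤ + N ℤ.* (F (S ∩ (X ∪ ⁅ e ⁆)) ℤ.- F (S ∩ X))
    χ-increment X e with e ∈? S
    ... | yes e∈S = ℤ.*-monoˡ-≤-nonNeg (+ N) (subst
          (λ Y → F (X ∪ ⁅ e ⁆) ℤ.- F X ℤ.≤ F Y ℤ.- F (S ∩ X)) (sym (∈⇒∩-∪⁅⁆ X e∈S))
          (submodular e (p∩q⊆q S X) (λ e∈X → x∈p∩q⁺ (e∈S , e∈X))))
    ... | no  e∉S = ℤ.≤-reflexive (sym (trans
          (cong (λ Y → + N ℤ.* (F Y ℤ.- F (S ∩ X))) (∉⇒∩-∪⁅⁆ X e∉S))
          (trans (cong (+ N ℤ.*_) (ℤ.+-inverseʳ (F (S ∩ X)))) (ℤ.*-zeroʳ (+ N)))))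

    -- Summation by parts, one element at a time. With increment g = a′ - a, expanding the square
    -- produces -2yg = 2ya - 2ya′; the term 2ya′ of the inner bound cancels the second part, and ya
    -- ≤ ua because a ≥ 0. The rest is g² ≤ M and `χ-increment`.
    bound-step : ∀ X e y u L L′ → 0ℤ ℤ.≤ F X → y ℤ.≤ u → Φ L′ ℤ.≤ bound (X ∪ ⁅ e ⁆) y L →
      Φ ((e , clip (y ℤ.- (F (X ∪ ⁅ e ⁆) ℤ.- F X))) ∷ L′) ℤ.≤ bound X u ((e , y) ∷ L)
    bound-step X e y u L L′ 0≤FX y≤u Φ≤ = begin
      square (clip (y ℤ.- (a′ ℤ.- a)) ℤ.- χ e) ℤ.+ Φ L′
        ≤⟨ ℤ.+-mono-≤ (clip-contracts (y ℤ.- (a′ ℤ.- a)) (proj₁ (χ-InBox e)) (proj₂ (χ-InBox e))) Φ≤ ⟩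
      square (y ℤ.- (a′ ℤ.- a) ℤ.- χ e) ℤ.+ bound (X ∪ ⁅ e ⁆) y L
        ≡⟨ expand y a a′ (χ e) (Φ L) (+ length L ℤ.* + M) 2N (F S) b′ ⟩
      known ℤ.+ (+ 2 ℤ.* (χ e ℤ.* (a′ ℤ.- a)) ℤ.+ square (a′ ℤ.- a) ℤ.+ + 2 ℤ.* (y ℤ.* a))
        ≤⟨ ℤ.+-monoʳ-≤ known (ℤ.+-mono-≤ (ℤ.+-mono-≤
             (ℤ.*-monoˡ-≤-nonNeg (+ 2) (χ-increment X e))
             (increment² X e))
             (ℤ.*-monoˡ-≤-nonNeg (+ 2) (ℤ.*-monoʳ-≤-nonNeg a {{ℤ.nonNegative 0≤FX}} y≤u))) ⟩
      known ℤ.+ (+ 2 ℤ.* (+ N ℤ.* (b′ ℤ.- b)) ℤ.+ + M ℤ.+ + 2 ℤ.* (u ℤ.* a))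
        ≡⟨ collect (square (y ℤ.- χ e)) u a (Φ L) (+ length L) (+ M) (+ N) (F S) b b′ ⟩
      bound X u ((e , y) ∷ L) ∎
      where
      open ℤ.≤-Reasoning
      a a′ b b′ known : ℤ
      a  = F X
      a′ = F (X ∪ ⁅ e ⁆)
      b  = F (S ∩ X)
      b′ = F (S ∩ (X ∪ ⁅ e ⁆))
      known = square (y ℤ.- χ e) ℤ.+ Φ L ℤ.+ + length L ℤ.* + M ℤ.+ 2N ℤ.* (F S ℤ.- b′)

      expand : ∀ y a a′ c p l n s b′ →
        (y ℤ.- (a′ ℤ.- a) ℤ.- c) ℤ.* (y ℤ.- (a′ ℤ.- a) ℤ.- c)
          ℤ.+ (p ℤ.+ l ℤ.+ + 2 ℤ.* (y ℤ.* a′) ℤ.+ n ℤ.* (s ℤ.- b′)) ≡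
        ((y ℤ.- c) ℤ.* (y ℤ.- c) ℤ.+ p ℤ.+ l ℤ.+ n ℤ.* (s ℤ.- b′))
          ℤ.+ (+ 2 ℤ.* (c ℤ.* (a′ ℤ.- a)) ℤ.+ (a′ ℤ.- a) ℤ.* (a′ ℤ.- a) ℤ.+ + 2 ℤ.* (y ℤ.* a))
      expand = solve-∀

      collect : ∀ q u a p l M n s b b′ →
        (q ℤ.+ p ℤ.+ l ℤ.* M ℤ.+ (+ 2 ℤ.* n) ℤ.* (s ℤ.- b′))
          ℤ.+ (+ 2 ℤ.* (n ℤ.* (b′ ℤ.- b)) ℤ.+ M ℤ.+ + 2 ℤ.* (u ℤ.* a)) ≡
        (q ℤ.+ p) ℤ.+ (+ 1 ℤ.+ l) ℤ.* M ℤ.+ + 2 ℤ.* (u ℤ.* a) ℤ.+ (+ 2 ℤ.* n) ℤ.* (s ℤ.- b)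
      collect = solve-∀

    -- Since the values descend, the value just treated bounds all later ones and becomes the next
    -- `u`. A negative value of `F` ends the search with the required answer, so the continuation is
    -- reached only with `F` nonnegative on the chain.
    sweep-false : ∀ X u L {k} → 0ℤ ℤ.≤ u → 0ℤ ℤ.≤ F X →
      InBox L → All (λ (_ , y) → y ℤ.≤ u) L → AllPairs (λ (_ , y) (_ , y′) → y′ ℤ.≤ y) L →
      (∀ i → i ∈ X ⊎ i ∈ˡ elements L) →
      (∀ L′ → elements L′ ≡ elements L → InBox L′ → Φ L′ ℤ.≤ bound X u L → eval F (k L′) ≡ false) →
      eval F (sweep X (F X) L k) ≡ false
    -- With the list exhausted, `X` contains every index, so the last term of the bound is zero and
    -- what remains is nonnegative.
    sweep-false X u [] 0≤u 0≤FX _ _ _ cover k-false = k-false [] refl [] (begin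
        0ℤ
          ≤⟨ subst (ℤ._≤ + 2 ℤ.* (u ℤ.* F X)) (cong (+ 2 ℤ.*_) (ℤ.*-zeroˡ (F X)))
               (ℤ.*-monoˡ-≤-nonNeg (+ 2) (ℤ.*-monoʳ-≤-nonNeg (F X) {{ℤ.nonNegative 0≤FX}} 0≤u)) ⟩
        + 2 ℤ.* (u ℤ.* F X)
          ≡⟨ pad (+ 2 ℤ.* (u ℤ.* F X)) (+ M) 2N (F S) ⟩
        0ℤ ℤ.+ 0ℤ ℤ.* + M ℤ.+ + 2 ℤ.* (u ℤ.* F X) ℤ.+ 2N ℤ.* (F S ℤ.- F S)
          ≡⟨ cong (λ Y → 0ℤ ℤ.+ 0ℤ ℤ.* + M ℤ.+ + 2 ℤ.* (u ℤ.* F X) ℤ.+ 2N ℤ.* (F S ℤ.- F Y)) S∩X≡S ⟨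
        bound X u [] ∎)
      where
      open ℤ.≤-Reasoning
      S∩X≡S : S ∩ X ≡ S
      S∩X≡S = ⊆-antisym (p∩q⊆p S X) λ {i} i∈S →
        x∈p∩q⁺ (i∈S , Sum.[ (λ i∈X → i∈X) , (λ ()) ]′ (cover i))
      pad : ∀ x m n s → x ≡ 0ℤ ℤ.+ 0ℤ ℤ.* m ℤ.+ x ℤ.+ n ℤ.* (s ℤ.- s)
      pad = solve-∀
    sweep-false X u ((e , y) ∷ L) {k} 0≤u 0≤FX ((0≤y , y≤N) ∷ box) (y≤u ∷ _) (≤y ∷ desc) cover k-false
      with F (X ∪ ⁅ e ⁆) ℤ.<? 0ℤ
    ... | yes _   = refl
    ... | no  F≮0 = sweep-false (X ∪ ⁅ e ⁆) y L 0≤y (ℤ.≮⇒≥ F≮0) box ≤y desc cover′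
        λ L′ eq box′ Φ≤ → k-false _ (cong (e ∷_) eq) (clip-InBox (y ℤ.- (F (X ∪ ⁅ e ⁆) ℤ.- F X)) ∷ box′)
          (bound-step X e y u L L′ 0≤FX y≤u Φ≤)
      where
      cover′ : ∀ i → i ∈ X ∪ ⁅ e ⁆ ⊎ i ∈ˡ elements L
      cover′ i with cover i
      ... | inj₁ i∈X          = inj₁ (p⊆p∪q ⁅ e ⁆ i∈X)
      ... | inj₂ (here refl)  = inj₁ (q⊆p∪q X ⁅ e ⁆ (x∈⁅x⁆ e))
      ... | inj₂ (there i∈L)  = inj₂ i∈L

    -- The two terms in `F X` cancel, because the a priori bound on the coordinates and the height
    -- of the target are both `N`. What remains is r·M + 2N·F S, at most N - 2N.
    descent : ∀ {X} L → X ⊆ S → length L ≡ r → bound X (+ N) L ℤ.+ + N ℤ.≤ Φ L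
    descent {X} L X⊆S ∣L∣ = begin
      bound X (+ N) L ℤ.+ + N
        ≡⟨ cong₂ (λ Y l → Φ L ℤ.+ + l ℤ.* + M ℤ.+ + 2 ℤ.* (+ N ℤ.* F X) ℤ.+ 2N ℤ.* (F S ℤ.- F Y) ℤ.+ + N)
             S∩X≡X ∣L∣ ⟩
      Φ L ℤ.+ + r ℤ.* + M ℤ.+ + 2 ℤ.* (+ N ℤ.* F X) ℤ.+ 2N ℤ.* (F S ℤ.- F X) ℤ.+ + N
        ≡⟨ cancel (Φ L) (+ r ℤ.* + M) (+ N) (F X) (F S) ⟩
      (Φ L ℤ.+ (+ r ℤ.* + M ℤ.+ + N)) ℤ.+ 2N ℤ.* F S
        ≤⟨ ℤ.+-mono-≤ (ℤ.+-monoʳ-≤ (Φ L) (ℤ.+-monoˡ-≤ (+ N) rM≤N))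
                      (ℤ.*-monoˡ-≤-nonNeg 2N {{ℤ.nonNegative 0≤2N}} FS≤-1) ⟩
      (Φ L ℤ.+ (+ N ℤ.+ + N)) ℤ.+ 2N ℤ.* ℤ.-1ℤ
        ≡⟨ cancel′ (Φ L) (+ N) ⟩
      Φ L ∎
      where
      open ℤ.≤-Reasoning
      S∩X≡X : S ∩ X ≡ X
      S∩X≡X = ⊆-antisym (p∩q⊆q S X) λ i∈X → x∈p∩q⁺ (X⊆S i∈X , i∈X)
      FS≤-1 : F S ℤ.≤ ℤ.-1ℤ
      FS≤-1 = ℤ.i<j⇒i≤pred[j] FS<0
      0≤2N : 0ℤ ℤ.≤ 2N
      0≤2N = subst (0ℤ ℤ.≤_) (ℤ.pos-* 2 N) (+≤+ ℕ.z≤n)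
      rM≤N : + r ℤ.* + M ℤ.≤ + N
      rM≤N = subst (ℤ._≤ + N) (ℤ.pos-* r M)
        (+≤+ (subst (r ℕ.* M ℕ.≤_) (sym N≡) (ℕ.n≤1+n (r ℕ.* M))))
      cancel : ∀ p l n x s →
        p ℤ.+ l ℤ.+ + 2 ℤ.* (n ℤ.* x) ℤ.+ (+ 2 ℤ.* n) ℤ.* (s ℤ.- x) ℤ.+ n ≡
        (p ℤ.+ (l ℤ.+ n)) ℤ.+ (+ 2 ℤ.* n) ℤ.* s
      cancel = solve-∀
      cancel′ : ∀ p n → (p ℤ.+ (n ℤ.+ n)) ℤ.+ (+ 2 ℤ.* n) ℤ.* ℤ.-1ℤ ≡ p
      cancel′ = solve-∀

    -- A completed round lowers the potential by at least `N`, so the strict inequality survives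
    -- with one round fewer. With no rounds left it contradicts `0≤Φ`: some sweep must have met a
    -- violating set.
    rounds-false : ∀ T X L {next} → X ⊆ S → 0ℤ ℤ.≤ F X → elements L ↭ allFin r → InBox L →
      Φ L ℤ.< + T ℤ.* + N → eval F (rounds T X (F X) L next) ≡ false
    rounds-false ℕ.zero    X L X⊆S 0≤FX els box Φ< = contradiction (0≤Φ L) (ℤ.<⇒≱ Φ<)
    rounds-false (ℕ.suc T) X L X⊆S 0≤FX els box Φ< =
      sweep-false X (+ N) (sort L) (+≤+ ℕ.z≤n) 0≤FX box′ (All.map proj₂ box′)
        (Linked⇒AllPairs (λ x≥y y≥z → ℤ.≤-trans y≥z x≥y) (sort-↗ L))
        (λ i → inj₂ (∈-resp-↭ (↭-sym els′) (∈-allFin i)))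
        λ L′ eq box″ Φ≤ → rounds-false T X L′ X⊆S 0≤FX (↭-trans (↭-reflexive eq) els′) box″
          (ℤ.≰⇒> λ TN≤Φ′ → ℤ.<⇒≱ (ℤ.≤-<-trans (Φ-decreases L′ Φ≤) (subst (λ z → Φ L ℤ.< z) (suc-* (+ T) (+ N)) Φ<))
            (ℤ.+-monoˡ-≤ (+ N) TN≤Φ′))
      where
      box′ : InBox (sort L)
      box′ = All-resp-↭ (↭-sym (sort-↭ L)) box
      els′ : elements (sort L) ↭ allFin r
      els′ = ↭-trans (map⁺ proj₁ (sort-↭ L)) els
      ∣sortL∣ : length (sort L) ≡ r
      ∣sortL∣ = trans (sym (List.length-map proj₁ (sort L)))
        (trans (↭-length els′) (List.length-tabulate (λ i → i)))
      Φ-decreases : ∀ L′ → Φ L′ ℤ.≤ bound X (+ N) (sort L) → Φ L′ ℤ.+ + N ℤ.≤ Φ L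
      Φ-decreases L′ Φ≤ = begin
        Φ L′ ℤ.+ + N                      ≤⟨ ℤ.+-monoˡ-≤ (+ N) Φ≤ ⟩
        bound X (+ N) (sort L) ℤ.+ + N    ≤⟨ descent (sort L) X⊆S ∣sortL∣ ⟩
        Φ (sort L)                        ≡⟨ Φ-↭ (sort-↭ L) ⟩
        Φ L                               ∎
        where open ℤ.≤-Reasoning
      suc-* : ∀ t n → (+ 1 ℤ.+ t) ℤ.* n ≡ t ℤ.* n ℤ.+ n
      suc-* = solve-∀

    Φ-initial : ∀ (is : List (Fin r)) → Φ (List.map (_, 0ℤ) is) ℤ.≤ + length is ℤ.* (+ N ℤ.* + N)
    Φ-initial []       = ℤ.≤-refl
    Φ-initial (i ∷ is) = begin
      square (0ℤ ℤ.- χ i) ℤ.+ Φ (List.map (_, 0ℤ) is)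
        ≡⟨ cong (ℤ._+ Φ (List.map (_, 0ℤ) is)) (square-neg 0ℤ (χ i)) ⟩
      square (χ i ℤ.- 0ℤ) ℤ.+ Φ (List.map (_, 0ℤ) is)
        ≤⟨ ℤ.+-mono-≤ (square-mono (ℤ.i≤j⇒0≤j-i (proj₁ (χ-InBox i)))
             (subst (ℤ._≤ + N) (sym (ℤ.+-identityʳ (χ i))) (proj₂ (χ-InBox i)))) (Φ-initial is) ⟩
      + N ℤ.* + N ℤ.+ + length is ℤ.* (+ N ℤ.* + N)
        ≡⟨ ℤ.suc-* (+ length is) (+ N ℤ.* + N) ⟨
      + length (i ∷ is) ℤ.* (+ N ℤ.* + N) ∎
      where open ℤ.≤-Reasoning

    search-false : ∀ {X Xs} → X ∈ˡ Xs → X ⊆ S → eval F (search (1 ℕ.+ r ℕ.* N) Xs) ≡ false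
    search-false {X} {X′ ∷ Xs} X∈ X⊆S with F X′ ℤ.<? 0ℤ
    search-false {X} {X′ ∷ Xs} X∈          X⊆S | yes _   = refl
    search-false {X} {X  ∷ Xs} (here refl) X⊆S | no  F≮0 =
      rounds-false (1 ℕ.+ r ℕ.* N) X initial X⊆S (ℤ.≮⇒≥ F≮0) (↭-reflexive elements-initial) initial-InBox Φ<
      where
      open ℤ.≤-Reasoning
      Φ< : Φ initial ℤ.< + (1 ℕ.+ r ℕ.* N) ℤ.* + N
      Φ< = begin-strict
        Φ initial                          ≤⟨ Φ-initial (allFin r) ⟩
        + length (allFin r) ℤ.* (+ N ℤ.* + N) ≡⟨ cong (λ n → + n ℤ.* (+ N ℤ.* + N)) (List.length-tabulate {n = r} (λ i → i)) ⟩
        + r ℤ.* (+ N ℤ.* + N)              ≡⟨ ℤ.*-assoc (+ r) (+ N) (+ N) ⟨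
        + r ℤ.* + N ℤ.* + N                ≡⟨ cong (ℤ._* + N) (ℤ.pos-* r N) ⟨
        -- The additional round makes the estimate strict, as `N` is positive by its summand 1.
        + (r ℕ.* N) ℤ.* + N                <⟨ ℤ.*-monoʳ-<-pos (+ N) {{positive}} (ℤ.+<+ (ℕ.n<1+n (r ℕ.* N))) ⟩
        + (1 ℕ.+ r ℕ.* N) ℤ.* + N          ∎
        where
        positive : ℤ.Positive (+ N)
        positive = subst (ℤ.Positive ∘ +_) (sym N≡) _
    -- The pair `X′` need not lie in `S`, so nothing is known about its descent; but that either
    -- answers false or passes on to the next pair.
    search-false {X} {X′ ∷ Xs} (there X∈)  X⊆S | no  _   = rounds-next (1 ℕ.+ r ℕ.* N) initial (search-false X∈ X⊆S)
      where
      sweep-next : ∀ {X v} L {k} → (∀ L′ → eval F (k L′) ≡ false) → eval F (sweep X v L k) ≡ false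
      sweep-next []            k-false = k-false []
      sweep-next {X} ((e , y) ∷ L) k-false with F (X ∪ ⁅ e ⁆) ℤ.<? 0ℤ
      ... | yes _ = refl
      ... | no  _ = sweep-next L (λ L′ → k-false _)

      rounds-next : ∀ T {X v} L {next} → eval F next ≡ false → eval F (rounds T X v L next) ≡ false
      rounds-next ℕ.zero    L next-false = next-false
      rounds-next (ℕ.suc T) L next-false = sweep-next (sort L) λ L′ → rounds-next T L′ next-false

-- Computation trees

module _ {I : Set} where

  weaken : ∀ {n} → Operand I n → Operand I (ℕ.suc n)
  weaken (input i) = input i
  weaken (value k) = value (suc k)
  weaken 𝟘         = 𝟘
  weaken 𝟙         = 𝟙

  weaken³ : ∀ {n} → Operand I n → Operand I (3 ℕ.+ n)
  weaken³ = weaken ∘ weaken ∘ weaken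

  -- (w , x , y , z) stands for w * x - y * z.
  Minor : ℕ → Set
  Minor n = Operand I n × Operand I n × Operand I n × Operand I n

  weakenMinor : ∀ {n} → Minor n → Minor (3 ℕ.+ n)
  weakenMinor (w , x , y , z) = weaken³ w , weaken³ x , weaken³ y , weaken³ z

  -- Each minor takes three operations and shifts all indices by three. The number of values at the
  -- end is therefore left to the continuation, which receives the map `ren` from old operands to
  -- new ones.
  computeMinors : ∀ N {n} → (Fin N → Minor n) →
                  (∀ {n′} → (Operand I n → Operand I n′) → (Fin N → Operand I n′) → Tree I n′) → Tree I n
  computeMinors ℕ.zero    f k = k id λ ()
  computeMinors (ℕ.suc N) f k = let (w , x , y , z) = f zero in
    compute mul w x (compute mul (weaken y) (weaken z) (compute sub (value (suc zero)) (value zero)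
      (computeMinors N (weakenMinor ∘ f ∘ suc) λ ren g →
        k (ren ∘ weaken³) λ { zero → ren (value zero) ; (suc i) → g i })))

  -- Trees only compare by `<`, so an entry is found to be nonzero by up to two comparisons with
  -- zero. The continuations are copied into many branches, but time counts only the path executed,
  -- not the size of the tree.
  findPivot : ∀ {q n} → Subset q → (Fin q → Operand I n) → List (Fin q) →
              (Fin q → Tree I n) → Tree I n → Tree I n
  findPivot T row []       found none = none
  findPivot T row (i ∷ is) found none =
    if does (i ∈? T)
    then if row i < 𝟘 then found i else if 𝟘 < row i then found i else findPivot T row is found none
    else findPivot T row is found none

  -- The continuation accepts any number of stored values: only the Boolean outlives a test, and the
  -- next one starts afresh from the inputs.
  testIndependence : ∀ p {q n} → (Fin p → Fin q → Operand I n) → Subset q →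
                     (Bool → ∀ {n′} → Tree I n′) → Tree I n
  testIndependence ℕ.zero        X T k = k (does (¬? (nonempty? T)))
  testIndependence (ℕ.suc p) {q} X T k = findPivot T (X zero) (allFin q)
    (λ c → computeMinors (p ℕ.* q)
      (λ ai → let (a , i) = remQuot q ai in X zero c , X (suc a) i , X zero i , X (suc a) c)
      (λ _ g → testIndependence p (λ a i → g (combine a i)) (T ∖ c) k))
    (testIndependence p (X ∘ suc) T k)

-- Two comparisons per column and three operations per minor, charged even when no pivot is found.
testCost : ℕ → ℕ → ℕ
testCost ℕ.zero    q = 0
testCost (ℕ.suc p) q = q ℕ.* 2 ℕ.+ (p ℕ.* q ℕ.* 3 ℕ.+ testCost p q)

testCost≤ : ∀ {p P} q → p ℕ.≤ P → testCost p q ℕ.≤ p ℕ.* (q ℕ.* 2 ℕ.+ P ℕ.* q ℕ.* 3)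
testCost≤ {ℕ.zero}      q p≤P = ℕ.z≤n
testCost≤ {ℕ.suc p} {P} q p<P = ℕ.≤-trans (ℕ.≤-reflexive (sym (ℕ.+-assoc (q ℕ.* 2) _ _)))
  (ℕ.+-mono-≤ (ℕ.+-monoʳ-≤ (q ℕ.* 2) (ℕ.*-monoˡ-≤ 3 (ℕ.*-monoˡ-≤ q (ℕ.<⇒≤ p<P))))
    (testCost≤ q (ℕ.<⇒≤ p<P)))

module Compilation (m r : ℕ) (d : Fin m → ℕ) where

  compile : Program (Fin m × Subset r) Bool Bool → ∀ {n} → Tree (Entry m r d) n
  compile (return b)      = answer b
  compile (ask (j , T) k) = testIndependence (d j) (λ a i → input (j , a , i)) T (λ b → compile (k b))

-- Execution of the trees: answers and time bounds

module Runs (ℝ : Reals) {I : Set} (ρ : I → Reals.Carrier ℝ) where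
  open Reals ℝ using (Carrier; _≈_; 0#; compare; _*_; _-_; _<?_)
  private module R = Reals ℝ
  open LinearAlgebra ℝ
  open Independence ℝ
  open Execution ℝ

  record Runs {n} (t : Tree I n) (vs : Vec Carrier n) (b : Bool) (bound : ℕ) : Set where
    constructor runs
    field
      {time} : ℕ
      run≡   : run ρ t vs ≡ just (b , time)
      time≤  : time ℕ.≤ bound

  module _ {n : ℕ} {vs : Vec Carrier n} {b : Bool} {B : ℕ} where

    runs-compute : ∀ {o x y t v} → apply o (⟦ ρ ⟧ x vs) (⟦ ρ ⟧ y vs) ≡ just v →
                   Runs t (v ∷ vs) b B → Runs (compute o x y t) vs b (ℕ.suc B)
    runs-compute {t = t} eq (runs run≡ ≤B) = runs
      (trans (cong (Maybe._>>= λ v → tick ρ (run ρ t (v ∷ vs))) eq) (cong (tick ρ) run≡)) (ℕ.s≤s ≤B)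

    runs-if : ∀ {x y t u} → (⟦ ρ ⟧ x vs R.< ⟦ ρ ⟧ y vs → Runs t vs b B) →
              (¬ ⟦ ρ ⟧ x vs R.< ⟦ ρ ⟧ y vs → Runs u vs b B) →
              Runs (if x < y then t else u) vs b (ℕ.suc B)
    runs-if {x} {y} {t} {u} runs-t runs-u = branch (⟦ ρ ⟧ x vs <? ⟦ ρ ⟧ y vs) refl
      where
      branch : ∀ x<?y → (⟦ ρ ⟧ x vs <? ⟦ ρ ⟧ y vs) ≡ x<?y → Runs (if x < y then t else u) vs b (ℕ.suc B)
      branch (yes x<y) eq = let runs run≡ ≤B = runs-t x<y in runs (trans
        (cong (λ c → tick ρ (if does c then run ρ t vs else run ρ u vs)) eq) (cong (tick ρ) run≡)) (ℕ.s≤s ≤B)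
      branch (no x≮y)  eq = let runs run≡ ≤B = runs-u x≮y in runs (trans
        (cong (λ c → tick ρ (if does c then run ρ t vs else run ρ u vs)) eq) (cong (tick ρ) run≡)) (ℕ.s≤s ≤B)

  runs-≤ : ∀ {n} {t : Tree I n} {vs b B B′} → B ℕ.≤ B′ → Runs t vs b B → Runs t vs b B′
  runs-≤ B≤B′ (runs run≡ ≤B) = runs run≡ (ℕ.≤-trans ≤B B≤B′)

  ⟦weaken⟧ : ∀ {n} (o : Operand I n) {v vs} → ⟦ ρ ⟧ (weaken o) (v ∷ vs) ≡ ⟦ ρ ⟧ o vs
  ⟦weaken⟧ (input i) = refl
  ⟦weaken⟧ (value k) = refl
  ⟦weaken⟧ 𝟘         = refl
  ⟦weaken⟧ 𝟙         = refl

  ⟦weaken³⟧ : ∀ {n} (o : Operand I n) {u v w vs} → ⟦ ρ ⟧ (weaken³ o) (u ∷ v ∷ w ∷ vs) ≡ ⟦ ρ ⟧ o vs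
  ⟦weaken³⟧ o = trans (⟦weaken⟧ (weaken (weaken o))) (trans (⟦weaken⟧ (weaken o)) (⟦weaken⟧ o))

  ⟦_⟧ᴹ : ∀ {n} → Minor n → Vec Carrier n → Carrier
  ⟦ w , x , y , z ⟧ᴹ vs = ⟦ ρ ⟧ w vs * ⟦ ρ ⟧ x vs - ⟦ ρ ⟧ y vs * ⟦ ρ ⟧ z vs

  minor-cong : ∀ {w w′ x x′ y y′ z z′} → w ≡ w′ → x ≡ x′ → y ≡ y′ → z ≡ z′ →
               w * x - y * z ≡ w′ * x′ - y′ * z′
  minor-cong refl refl refl refl = refl

  ⟦weakenMinor⟧ : ∀ {n} (o : Minor n) {u v w vs} → ⟦ weakenMinor o ⟧ᴹ (u ∷ v ∷ w ∷ vs) ≡ ⟦ o ⟧ᴹ vs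
  ⟦weakenMinor⟧ (w , x , y , z) = minor-cong (⟦weaken³⟧ w) (⟦weaken³⟧ x) (⟦weaken³⟧ y) (⟦weaken³⟧ z)

  runs-computeMinors : ∀ N {n} {vs : Vec Carrier n} (f : Fin N → Minor n)
    {k : ∀ {n′} → (Operand I n → Operand I n′) → (Fin N → Operand I n′) → Tree I n′} {b B} →
    (∀ {n′} (ren : Operand I n → Operand I n′) g vs′ → (∀ o → ⟦ ρ ⟧ (ren o) vs′ ≡ ⟦ ρ ⟧ o vs) →
      (∀ i → ⟦ ρ ⟧ (g i) vs′ ≡ ⟦ f i ⟧ᴹ vs) → Runs (k ren g) vs′ b B) →
    Runs (computeMinors N f k) vs b (N ℕ.* 3 ℕ.+ B)
  runs-computeMinors ℕ.zero    {vs = vs} f k-runs = k-runs id _ vs (λ _ → refl) (λ ())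
  runs-computeMinors (ℕ.suc N) {vs = vs} f {k} {b} {B} k-runs =
    runs-compute refl (runs-compute refl (runs-compute refl
      (runs-computeMinors N (weakenMinor ∘ f ∘ suc) λ ren g vs′ ren≡ g≡ →
        k-runs _ _ vs′ (λ o → trans (ren≡ (weaken³ o)) (⟦weaken³⟧ o)) λ where
          zero    → trans (ren≡ (value zero))
            (minor-cong refl refl (⟦weaken⟧ (proj₁ (proj₂ (proj₂ (f zero)))))
              (⟦weaken⟧ (proj₂ (proj₂ (proj₂ (f zero))))))
          (suc i) → trans (g≡ i) (⟦weakenMinor⟧ (f (suc i))))))

  runs-findPivot : ∀ {q n} {vs : Vec Carrier n} T row (is : List (Fin q)) {found none b B} →
    (∀ i → i ∈ T → ¬ ⟦ ρ ⟧ (row i) vs ≈ 0# → Runs (found i) vs b B) →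
    (All (λ i → i ∈ T → ⟦ ρ ⟧ (row i) vs ≈ 0#) is → Runs none vs b B) →
    Runs (findPivot T row is found none) vs b (length is ℕ.* 2 ℕ.+ B)
  runs-findPivot T row [] found none = none []
  runs-findPivot {vs = vs} T row (i ∷ is) found none with i ∈? T
  ... | no  i∉T = runs-≤ (ℕ.m≤n+m _ 2)
    (runs-findPivot T row is found λ zeros → none ((λ i∈T → contradiction i∈T i∉T) ∷ zeros))
  ... | yes i∈T with compare (⟦ ρ ⟧ (row i) vs) 0#
  ...   | tri< x<0 x≉0 _   = runs-≤ (ℕ.s≤s (ℕ.≤-trans (ℕ.m≤n+m _ (length is ℕ.* 2)) (ℕ.n≤1+n _))) (runs-if
          (λ _ → found i i∈T x≉0) (λ x≮0 → contradiction x<0 x≮0))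
  ...   | tri≈ x≮0 x≈0 x≯0 = runs-if (λ x<0 → contradiction x<0 x≮0) λ _ →
          runs-if (λ x>0 → contradiction x>0 x≯0) λ _ →
          runs-findPivot T row is found λ zeros → none ((λ _ → x≈0) ∷ zeros)
  ...   | tri> x≮0 x≉0 x>0 = runs-if (λ x<0 → contradiction x<0 x≮0) λ _ →
          runs-≤ (ℕ.s≤s (ℕ.m≤n+m _ (length is ℕ.* 2)))
            (runs-if (λ _ → found i i∈T x≉0) (λ x≯0 → contradiction x>0 x≯0))

  -- The tree need not imitate the elimination with division inside `independent?`: decisions of
  -- equivalent propositions have the same Boolean, so `noRows`, `zeroRow` and `pivotRow` suffice.
  -- `A` names the matrix of current values while the operands change.
  runs-testIndependence : ∀ p {q n} {vs : Vec Carrier n} X T {k b B} (A : Matrix ℝ p q) →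
    (∀ a i → ⟦ ρ ⟧ (X a i) vs ≡ A a i) →
    (∀ {n′} (vs′ : Vec Carrier n′) → Runs (k (does (independent? A T))) vs′ b B) →
    Runs (testIndependence p X T k) vs b (testCost p q ℕ.+ B)
  runs-testIndependence ℕ.zero {vs = vs} X T {k} {b} {B} A X≡A k-runs =
    subst (λ c → Runs (k c) vs b B)
      (does-⇔ (mk⇔ (Equivalence.from noRows) (Equivalence.to noRows)) (independent? A T) (¬? (nonempty? T)))
      (k-runs vs)
  runs-testIndependence (ℕ.suc p) {q} {vs = vs} X T {k} {b} {B} A X≡A k-runs = runs-≤ cost≤
    (runs-findPivot T (X zero) (allFin q)
      (λ c c∈T x≉0 →
        let pivot≉0 = λ A0c≈0 → x≉0 (R.trans (R.reflexive (X≡A zero c)) A0c≈0) in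
        runs-computeMinors (p ℕ.* q) _ λ ren g vs′ _ g≡ →
          runs-testIndependence p _ (T ∖ c) (eliminate A c)
            (λ a i → trans (g≡ (combine a i)) (trans
              (cong (λ (a , i) → ⟦ X zero c , X (suc a) i , X zero i , X (suc a) c ⟧ᴹ vs) (Fin.remQuot-combine a i))
              (minor-cong (X≡A zero c) (X≡A (suc a) i) (X≡A zero i) (X≡A (suc a) c))))
            (k-runs′ (pivotRow A T c c∈T pivot≉0)))
      (λ zeros → runs-≤ (ℕ.m≤n+m _ (p ℕ.* q ℕ.* 3))
        (runs-testIndependence p (X ∘ suc) T (A ∘ suc) (X≡A ∘ suc)
          (k-runs′ (zeroRow λ i i∈T → R.trans (R.reflexive (sym (X≡A zero i)))
            (All.lookup zeros (∈-allFin i) i∈T))))))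
    where
    k-runs′ : ∀ {A′ : Matrix ℝ p q} {T′} → Independent A′ T′ ⇔ Independent A T →
              ∀ {n′} (vs′ : Vec Carrier n′) → Runs (k (does (independent? A′ T′))) vs′ b B
    k-runs′ {A′} {T′} equiv vs′ = subst (λ c → Runs (k c) vs′ b B)
      (sym (does-⇔ equiv (independent? A′ T′) (independent? A T))) (k-runs vs′)

    cost≤ : length (allFin q) ℕ.* 2 ℕ.+ (p ℕ.* q ℕ.* 3 ℕ.+ (testCost p q ℕ.+ B)) ℕ.≤
            testCost (ℕ.suc p) q ℕ.+ B
    cost≤ = ℕ.≤-reflexive (trans
      (cong (λ n → n ℕ.* 2 ℕ.+ (p ℕ.* q ℕ.* 3 ℕ.+ (testCost p q ℕ.+ B))) (List.length-tabulate {n = q} id))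
      (trans (cong (q ℕ.* 2 ℕ.+_) (sym (ℕ.+-assoc (p ℕ.* q ℕ.* 3) (testCost p q) B)))
        (sym (ℕ.+-assoc (q ℕ.* 2) _ B))))

module _ (ℝ : Reals) {m r : ℕ} {d : Fin m → ℕ} (A : (j : Fin m) → Matrix ℝ (d j) r) where
  open LinearAlgebra ℝ
  open Compilation m r d

  independenceOracle : Fin m × Subset r → Bool
  independenceOracle (j , T) = does (independent? (A j) T)

  module _ (ρ : Entry m r d → Reals.Carrier ℝ) (ρ≡A : ∀ j a i → ρ (j , a , i) ≡ A j a i) where
    open Runs ℝ ρ

    runs-compile : ∀ {c} → (∀ j → testCost (d j) r ℕ.≤ c) → ∀ P {n} {vs : Vec (Reals.Carrier ℝ) n} →
      Runs (compile P) vs (eval independenceOracle P) (cost independenceOracle P ℕ.* c)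
    runs-compile ≤c (return b)      = runs refl ℕ.z≤n
    runs-compile ≤c (ask (j , T) k) = runs-≤ (ℕ.+-monoˡ-≤ _ (≤c j))
      (runs-testIndependence (d j) _ T (A j) (ρ≡A j) λ vs′ → runs-compile ≤c (k _))

-- The rank condition

sumℕ-mono : ∀ {n} {f g : Fin n → ℕ} → (∀ i → f i ℕ.≤ g i) → sumℕ f ℕ.≤ sumℕ g
sumℕ-mono {ℕ.zero}  f≤g = z≤n
sumℕ-mono {ℕ.suc n} f≤g = ℕ.+-mono-≤ (f≤g zero) (sumℕ-mono (f≤g ∘ suc))

sumℕ-cong : ∀ {n} {f g : Fin n → ℕ} → (∀ i → f i ≡ g i) → sumℕ f ≡ sumℕ g
sumℕ-cong {ℕ.zero}  f≡g = refl
sumℕ-cong {ℕ.suc n} f≡g = cong₂ ℕ._+_ (f≡g zero) (sumℕ-cong (f≡g ∘ suc))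

sumℕ-+ : ∀ {n} (f g : Fin n → ℕ) → sumℕ (λ i → f i ℕ.+ g i) ≡ sumℕ f ℕ.+ sumℕ g
sumℕ-+ {ℕ.zero}  f g = refl
sumℕ-+ {ℕ.suc n} f g = trans (cong (λ s → f zero ℕ.+ g zero ℕ.+ s) (sumℕ-+ (f ∘ suc) (g ∘ suc)))
  (interchange (f zero) (g zero) (sumℕ (f ∘ suc)) (sumℕ (g ∘ suc)))
  where
  interchange : ∀ a b c d → a ℕ.+ b ℕ.+ (c ℕ.+ d) ≡ a ℕ.+ c ℕ.+ (b ℕ.+ d)
  interchange = ℕ-Solver.solve-∀

sumℕ-suc : ∀ {n} (f : Fin n → ℕ) → sumℕ (λ i → ℕ.suc (f i)) ≡ sumℕ f ℕ.+ n
sumℕ-suc {ℕ.zero}  f = refl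
sumℕ-suc {ℕ.suc n} f = trans (cong (λ s → ℕ.suc (f zero ℕ.+ s)) (sumℕ-suc (f ∘ suc)))
  (shift (f zero) (sumℕ (f ∘ suc)) n)
  where
  shift : ∀ a b n → 1 ℕ.+ (a ℕ.+ (b ℕ.+ n)) ≡ a ℕ.+ b ℕ.+ (1 ℕ.+ n)
  shift = ℕ-Solver.solve-∀

member≤sumℕ : ∀ {n} (f : Fin n → ℕ) i → f i ℕ.≤ sumℕ f
member≤sumℕ f zero    = ℕ.m≤m+n (f zero) _
member≤sumℕ f (suc i) = ℕ.≤-trans (member≤sumℕ (f ∘ suc) i) (ℕ.m≤n+m _ (f zero))

size≤sumℕ : ∀ {n} (f : Fin n → ℕ) → (∀ i → 1 ℕ.≤ f i) → n ℕ.≤ sumℕ f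
size≤sumℕ {ℕ.zero}  f 1≤f = z≤n
size≤sumℕ {ℕ.suc n} f 1≤f = ℕ.+-mono-≤ (1≤f zero) (size≤sumℕ (f ∘ suc) (1≤f ∘ suc))

-- Ranks from independence queries

module RankProgram (m r : ℕ) where

  Query : Set
  Query = Fin m × Subset r

  greedy : Query → List (Fin r) → Subset r → Program Query Bool ℕ
  greedy (j , S) []       T = return ∣ T ∣
  greedy (j , S) (e ∷ es) T =
    if does (e ∈? S)
    then ask (j , T ∪ ⁅ e ⁆) (λ b → greedy (j , S) es (if b then T ∪ ⁅ e ⁆ else T))
    else greedy (j , S) es T

  rankProgram : Query → Program Query Bool ℕ
  rankProgram q = greedy q (allFin r) ⊥

  cost-rankProgram : ∀ oracle q → cost oracle (rankProgram q) ℕ.≤ r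
  cost-rankProgram oracle (j , S) =
    subst (λ n → cost oracle (rankProgram (j , S)) ℕ.≤ n) (List.length-tabulate {n = r} id) (go (allFin r) ⊥)
    where
    go : ∀ es T → cost oracle (greedy (j , S) es T) ℕ.≤ length es
    go []       T = z≤n
    go (e ∷ es) T with e ∈? S
    ... | yes _ = s≤s (go es _)
    ... | no  _ = ℕ.m≤n⇒m≤1+n (go es T)

  module _ (ℝ : Reals) {d : Fin m → ℕ} (A : (j : Fin m) → Matrix ℝ (d j) r) where
    open LinearAlgebra ℝ
    open Independence ℝ
    open Rank ℝ

    private
      oracle : Query → Bool
      oracle = independenceOracle ℝ A

    -- `X` collects the elements of `S` scanned so far, and `T` stays a maximum independent subset
    -- of it: a rejected element cannot raise the rank by `dependent⇒rank≤`, and an accepted one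
    -- raises it by at most one.
    eval-greedy : ∀ j S es {X T} → X ⊆ S → (∀ {i} → i ∈ S → i ∈ X ⊎ i ∈ˡ es) →
      T ⊆ X → Independent (A j) T → ∣ T ∣ ≡ rank (A j) X →
      eval oracle (greedy (j , S) es T) ≡ rank (A j) S
    eval-greedy j S [] X⊆S cover T⊆X ind ∣T∣≡ = trans ∣T∣≡
      (cong (rank (A j)) (⊆-antisym X⊆S λ i∈S → [ id , (λ ()) ]′ (cover i∈S)))
    eval-greedy j S (e ∷ es) {X} {T} X⊆S cover T⊆X ind ∣T∣≡ with e ∈? S
    ... | no  e∉S = eval-greedy j S es X⊆S cover′ T⊆X ind ∣T∣≡
      where
      cover′ : ∀ {i} → i ∈ S → i ∈ X ⊎ i ∈ˡ es
      cover′ i∈S with cover i∈S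
      ... | inj₁ i∈X         = inj₁ i∈X
      ... | inj₂ (here refl) = contradiction i∈S e∉S
      ... | inj₂ (there i∈)  = inj₂ i∈
    ... | yes e∈S = next (independent? (A j) (T ∪ ⁅ e ⁆))
      where
      cover′ : ∀ {i} → i ∈ S → i ∈ X ∪ ⁅ e ⁆ ⊎ i ∈ˡ es
      cover′ i∈S with cover i∈S
      ... | inj₁ i∈X         = inj₁ (p⊆p∪q ⁅ e ⁆ i∈X)
      ... | inj₂ (here refl) = inj₁ (x∈p∪q⁺ (inj₂ (x∈⁅x⁆ e)))
      ... | inj₂ (there i∈)  = inj₂ i∈

      extended : Independent (A j) (T ∪ ⁅ e ⁆) → rank (A j) (X ∪ ⁅ e ⁆) ℕ.≤ ∣ T ∪ ⁅ e ⁆ ∣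
      extended ind′ with e ∈? T
      -- The list may contain repetitions, so `e` can already belong to `T`; then neither set grows.
      ... | yes e∈T = ℕ.≤-reflexive (trans (cong (rank (A j)) (∈⇒∪⁅⁆≡ (T⊆X e∈T)))
            (trans (sym ∣T∣≡) (cong ∣_∣ (sym (∈⇒∪⁅⁆≡ e∈T)))))
      ... | no  e∉T = ℕ.≤-trans (rank-∪⁅⁆≤ (A j) X e)
            (subst (λ n → ℕ.suc n ℕ.≤ ∣ T ∪ ⁅ e ⁆ ∣) ∣T∣≡ (∣p∣<∣p∪⁅x⁆∣ e∉T))

      next : (t? : Dec (Independent (A j) (T ∪ ⁅ e ⁆))) →
        eval oracle (greedy (j , S) es (if does t? then T ∪ ⁅ e ⁆ else T)) ≡ rank (A j) S
      next (yes ind′) = eval-greedy j S es (p∪⁅x⁆⊆ X⊆S e∈S) cover′ (∪⁅⁆-monoˡ e T⊆X) ind′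
        (ℕ.≤-antisym (∣independent∣≤rank (A j) (∪⁅⁆-monoˡ e T⊆X) ind′) (extended ind′))
      next (no dep)   = eval-greedy j S es (p∪⁅x⁆⊆ X⊆S e∈S) cover′ (p⊆p∪q ⁅ e ⁆ ∘ T⊆X) ind
        (trans ∣T∣≡ (ℕ.≤-antisym (rank-⊆ (A j) (p⊆p∪q ⁅ e ⁆)) (dependent⇒rank≤ (A j) T⊆X ind dep)))

    eval-rankProgram : ∀ q → eval oracle (rankProgram q) ≡ rank (A (proj₁ q)) (proj₂ q)
    eval-rankProgram (j , S) = eval-greedy j S (allFin r) ⊥⊆ (λ {i} _ → inj₂ (∈-allFin i)) id
      Independent-⊥ (trans (∣⊥∣≡0 r) (sym (rank-⊥ (A j))))

-- The slack of the rank condition as a submodular function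

module Slack (m r : ℕ) where

  open import Data.Integer.Base using (+_)

  slack : ℕ → Subset r → ℤ
  slack s S = + (s ℕ.+ 1) ℤ.- + (2 ℕ.* ∣ S ∣ ℕ.+ m)

  totals : ∀ k → (Fin k → Fin m) → Subset r → Program (Fin m × Subset r) ℕ ℕ
  totals ℕ.zero    ι S = return 0
  totals (ℕ.suc k) ι S = ask (ι zero , S) λ a → totals k (ι ∘ suc) S >>= λ b → return (a ℕ.+ b)

  slackProgram : Subset r → Program (Fin m × Subset r) ℕ ℤ
  slackProgram S = totals m id S >>= λ s → return (slack s S)

  module _ (rk : Fin m → Subset r → ℕ) where

    private
      oracle : Fin m × Subset r → ℕ
      oracle (j , S) = rk j S

    F : Subset r → ℤ
    F S = slack (sumℕ λ j → rk j S) S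

    eval-totals : ∀ k ι S → eval oracle (totals k ι S) ≡ sumℕ (λ j → rk (ι j) S)
    eval-totals ℕ.zero    ι S = refl
    eval-totals (ℕ.suc k) ι S = trans (eval->>= oracle _ (totals k (ι ∘ suc) S))
      (cong (λ s → rk (ι zero) S ℕ.+ s) (eval-totals k (ι ∘ suc) S))

    cost-totals : ∀ k ι S → cost oracle (totals k ι S) ≡ k
    cost-totals ℕ.zero    ι S = refl
    cost-totals (ℕ.suc k) ι S = cong ℕ.suc (trans (cost->>= oracle _ (totals k (ι ∘ suc) S))
      (trans (ℕ.+-identityʳ _) (cost-totals k (ι ∘ suc) S)))

    eval-slackProgram : ∀ S → eval oracle (slackProgram S) ≡ F S
    eval-slackProgram S = trans (eval->>= oracle _ (totals m id S)) (cong (λ s → slack s S) (eval-totals m id S))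

    cost-slackProgram : ∀ S → cost oracle (slackProgram S) ℕ.≤ m
    cost-slackProgram S = ℕ.≤-reflexive (trans (cost->>= oracle _ (totals m id S))
      (trans (ℕ.+-identityʳ _) (cost-totals m id S)))

    0≤F⇔ : ∀ S → 0ℤ ℤ.≤ F S ⇔ 2 ℕ.* ∣ S ∣ ℕ.+ m ℕ.≤ sumℕ (λ j → rk j S) ℕ.+ 1
    0≤F⇔ S = mk⇔ (ℤ.drop‿+≤+ ∘ ℤ.0≤i-j⇒j≤i) (ℤ.i≤j⇒0≤j-i ∘ +≤+)

    difference : ∀ a b c d → + (a ℕ.+ 1) ℤ.- + (2 ℕ.* b ℕ.+ m) ℤ.- (+ (c ℕ.+ 1) ℤ.- + (2 ℕ.* d ℕ.+ m)) ≡
                             + (a ℕ.+ 2 ℕ.* d) ℤ.- + (c ℕ.+ 2 ℕ.* b)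
    difference a b c d = identity (+ a) (+ (2 ℕ.* b)) (+ c) (+ (2 ℕ.* d)) (+ m)
      where
      identity : ∀ a b c d m → a ℤ.+ + 1 ℤ.- (b ℤ.+ m) ℤ.- (c ℤ.+ + 1 ℤ.- (d ℤ.+ m)) ≡
                               (a ℤ.+ d) ℤ.- (c ℤ.+ b)
      identity = solve-∀

    F-difference : ∀ X Y → F X ℤ.- F Y ≡ + (sumℕ (λ j → rk j X) ℕ.+ 2 ℕ.* ∣ Y ∣) ℤ.- + (sumℕ (λ j → rk j Y) ℕ.+ 2 ℕ.* ∣ X ∣)
    F-difference X Y = difference (sumℕ λ j → rk j X) (∣ X ∣) (sumℕ λ j → rk j Y) (∣ Y ∣)

    module _ (rk-⊆ : ∀ j {X Y} → X ⊆ Y → rk j X ℕ.≤ rk j Y)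
             (rk-step : ∀ j X e → rk j (X ∪ ⁅ e ⁆) ℕ.≤ ℕ.suc (rk j X))
             (rk-submodular : ∀ j {X Y} e → Y ⊆ X → rk j (X ∪ ⁅ e ⁆) ℕ.+ rk j Y ℕ.≤ rk j (Y ∪ ⁅ e ⁆) ℕ.+ rk j X)
             where

      private
        Σrk : Subset r → ℕ
        Σrk X = sumℕ λ j → rk j X

        Σrk-submodular : ∀ {X Y} e → Y ⊆ X → Σrk (X ∪ ⁅ e ⁆) ℕ.+ Σrk Y ℕ.≤ Σrk (Y ∪ ⁅ e ⁆) ℕ.+ Σrk X
        Σrk-submodular {X} {Y} e Y⊆X = ≡.subst₂ ℕ._≤_
          (sumℕ-+ (λ j → rk j (X ∪ ⁅ e ⁆)) (λ j → rk j Y)) (sumℕ-+ (λ j → rk j (Y ∪ ⁅ e ⁆)) (λ j → rk j X))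
          (sumℕ-mono λ j → rk-submodular j e Y⊆X)

        Σrk-step : ∀ X e → Σrk (X ∪ ⁅ e ⁆) ℕ.≤ Σrk X ℕ.+ m
        Σrk-step X e = subst (λ n → Σrk (X ∪ ⁅ e ⁆) ℕ.≤ n) (sumℕ-suc λ j → rk j X)
          (sumℕ-mono λ j → rk-step j X e)

        size-modular : ∀ {X Y : Subset r} e → Y ⊆ X → (e ∈ X → e ∈ Y) →
                       ∣ Y ∪ ⁅ e ⁆ ∣ ℕ.+ ∣ X ∣ ℕ.≤ ∣ X ∪ ⁅ e ⁆ ∣ ℕ.+ ∣ Y ∣
        size-modular {X} {Y} e Y⊆X back with e ∈? X
        ... | yes e∈X = ℕ.≤-reflexive (trans (cong₂ ℕ._+_ (cong ∣_∣ (∈⇒∪⁅⁆≡ (back e∈X)))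
              (cong ∣_∣ (sym (∈⇒∪⁅⁆≡ e∈X)))) (ℕ.+-comm ∣ Y ∣ _))
        ... | no  e∉X = begin
              ∣ Y ∪ ⁅ e ⁆ ∣ ℕ.+ ∣ X ∣    ≤⟨ ℕ.+-monoˡ-≤ ∣ X ∣ (∣p∪⁅x⁆∣≤1+∣p∣ Y e) ⟩
              ℕ.suc (∣ Y ∣ ℕ.+ ∣ X ∣)    ≡⟨ cong ℕ.suc (ℕ.+-comm ∣ Y ∣ ∣ X ∣) ⟩
              ℕ.suc ∣ X ∣ ℕ.+ ∣ Y ∣      ≤⟨ ℕ.+-monoˡ-≤ ∣ Y ∣ (∣p∣<∣p∪⁅x⁆∣ e∉X) ⟩
              ∣ X ∪ ⁅ e ⁆ ∣ ℕ.+ ∣ Y ∣    ∎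
          where open ℕ.≤-Reasoning

        +-difference-≤ : ∀ a b c d → a ℕ.+ d ℕ.≤ c ℕ.+ b → + a ℤ.- + b ℤ.≤ + c ℤ.- + d
        +-difference-≤ a b c d a+d≤c+b = ℤ.0≤i-j⇒j≤i (subst (λ z → 0ℤ ℤ.≤ z)
          (rearrange (+ a) (+ b) (+ c) (+ d)) (ℤ.i≤j⇒0≤j-i (+≤+ a+d≤c+b)))
          where
          rearrange : ∀ a b c d → (c ℤ.+ b) ℤ.- (a ℤ.+ d) ≡ (c ℤ.- d) ℤ.- (a ℤ.- b)
          rearrange = solve-∀

      -- The proviso excludes `e` in `X` but not in `Y`, where the left side is zero while the right
      -- side may be negative on account of -2|S|. The descent uses `Y` = `S ∩ X` with `e` in `S`,
      -- which satisfies it.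
      F-submodular : ∀ {X Y} e → Y ⊆ X → (e ∈ X → e ∈ Y) →
                     F (X ∪ ⁅ e ⁆) ℤ.- F X ℤ.≤ F (Y ∪ ⁅ e ⁆) ℤ.- F Y
      F-submodular {X} {Y} e Y⊆X back = ≡.subst₂ ℤ._≤_
        (sym (F-difference (X ∪ ⁅ e ⁆) X)) (sym (F-difference (Y ∪ ⁅ e ⁆) Y)) (+-difference-≤
          (Σrk (X ∪ ⁅ e ⁆) ℕ.+ 2 ℕ.* ∣ X ∣) (Σrk X ℕ.+ 2 ℕ.* ∣ X ∪ ⁅ e ⁆ ∣)
          (Σrk (Y ∪ ⁅ e ⁆) ℕ.+ 2 ℕ.* ∣ Y ∣) (Σrk Y ℕ.+ 2 ℕ.* ∣ Y ∪ ⁅ e ⁆ ∣) (begin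
          Σrk (X ∪ ⁅ e ⁆) ℕ.+ 2 ℕ.* ∣ X ∣ ℕ.+ (Σrk Y ℕ.+ 2 ℕ.* ∣ Y ∪ ⁅ e ⁆ ∣)
            ≡⟨ regroup (Σrk (X ∪ ⁅ e ⁆)) (∣ X ∣) (Σrk Y) (∣ Y ∪ ⁅ e ⁆ ∣) ⟩
          (Σrk (X ∪ ⁅ e ⁆) ℕ.+ Σrk Y) ℕ.+ 2 ℕ.* (∣ Y ∪ ⁅ e ⁆ ∣ ℕ.+ ∣ X ∣)
            ≤⟨ ℕ.+-mono-≤ (Σrk-submodular e Y⊆X) (ℕ.*-monoʳ-≤ 2 (size-modular e Y⊆X back)) ⟩
          (Σrk (Y ∪ ⁅ e ⁆) ℕ.+ Σrk X) ℕ.+ 2 ℕ.* (∣ X ∪ ⁅ e ⁆ ∣ ℕ.+ ∣ Y ∣)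
            ≡⟨ regroup (Σrk (Y ∪ ⁅ e ⁆)) (∣ Y ∣) (Σrk X) (∣ X ∪ ⁅ e ⁆ ∣) ⟨
          Σrk (Y ∪ ⁅ e ⁆) ℕ.+ 2 ℕ.* ∣ Y ∣ ℕ.+ (Σrk X ℕ.+ 2 ℕ.* ∣ X ∪ ⁅ e ⁆ ∣) ∎))
        where
        open ℕ.≤-Reasoning
        regroup : ∀ a b c d → a ℕ.+ 2 ℕ.* b ℕ.+ (c ℕ.+ 2 ℕ.* d) ≡ (a ℕ.+ c) ℕ.+ 2 ℕ.* (d ℕ.+ b)
        regroup = ℕ-Solver.solve-∀

      -- One element raises each rank by 0 or 1 and the size by at most 1, so an increment lies
      -- between -2 and m; m + 2 dominates both absolute values.
      F-increment² : ∀ X e → square (F (X ∪ ⁅ e ⁆) ℤ.- F X) ℤ.≤ + ((m ℕ.+ 2) ℕ.* (m ℕ.+ 2))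
      F-increment² X e = subst (λ z → square (F (X ∪ ⁅ e ⁆) ℤ.- F X) ℤ.≤ z) (sym (ℤ.pos-* (m ℕ.+ 2) (m ℕ.+ 2)))
        (square-≤ lower upper)
        where
        open ℕ.≤-Reasoning
        w = F (X ∪ ⁅ e ⁆) ℤ.- F X

        square-≤ : ∀ {w K} → ℤ.- w ℤ.≤ K → w ℤ.≤ K → square w ℤ.≤ square K
        square-≤ {w} {K} -w≤K w≤K with ℤ.≤-total 0ℤ w
        ... | inj₁ 0≤w = square-mono 0≤w w≤K
        ... | inj₂ w≤0 = subst (λ z → z ℤ.≤ square K) (lemma w) (square-mono (ℤ.neg-mono-≤ w≤0) -w≤K)
          where
          lemma : ∀ w → (ℤ.- w) ℤ.* (ℤ.- w) ≡ w ℤ.* w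
          lemma = solve-∀

        upper : w ℤ.≤ + (m ℕ.+ 2)
        upper = ≡.subst₂ ℤ._≤_ (sym (F-difference (X ∪ ⁅ e ⁆) X)) (ℤ.+-identityʳ (+ (m ℕ.+ 2)))
          (+-difference-≤ (Σrk (X ∪ ⁅ e ⁆) ℕ.+ 2 ℕ.* ∣ X ∣) (Σrk X ℕ.+ 2 ℕ.* ∣ X ∪ ⁅ e ⁆ ∣) (m ℕ.+ 2) 0 (begin
            Σrk (X ∪ ⁅ e ⁆) ℕ.+ 2 ℕ.* ∣ X ∣ ℕ.+ 0
              ≡⟨ ℕ.+-identityʳ _ ⟩
            Σrk (X ∪ ⁅ e ⁆) ℕ.+ 2 ℕ.* ∣ X ∣
              ≤⟨ ℕ.+-mono-≤ (Σrk-step X e) (ℕ.*-monoʳ-≤ 2 (∣p∣≤∣p∪q∣ X ⁅ e ⁆)) ⟩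
            Σrk X ℕ.+ m ℕ.+ 2 ℕ.* ∣ X ∪ ⁅ e ⁆ ∣
              ≤⟨ ℕ.m≤n+m _ 2 ⟩
            2 ℕ.+ (Σrk X ℕ.+ m ℕ.+ 2 ℕ.* ∣ X ∪ ⁅ e ⁆ ∣)
              ≡⟨ regroup (Σrk X) m (∣ X ∪ ⁅ e ⁆ ∣) ⟩
            m ℕ.+ 2 ℕ.+ (Σrk X ℕ.+ 2 ℕ.* ∣ X ∪ ⁅ e ⁆ ∣) ∎))
          where
          regroup : ∀ a m b → 2 ℕ.+ (a ℕ.+ m ℕ.+ 2 ℕ.* b) ≡ m ℕ.+ 2 ℕ.+ (a ℕ.+ 2 ℕ.* b)
          regroup = ℕ-Solver.solve-∀

        lower : ℤ.- w ℤ.≤ + (m ℕ.+ 2)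
        lower = ≡.subst₂ ℤ._≤_
          (trans (sym (F-difference X (X ∪ ⁅ e ⁆))) (flip-sign (F X) (F (X ∪ ⁅ e ⁆)))) (ℤ.+-identityʳ (+ (m ℕ.+ 2)))
          (+-difference-≤ (Σrk X ℕ.+ 2 ℕ.* ∣ X ∪ ⁅ e ⁆ ∣) (Σrk (X ∪ ⁅ e ⁆) ℕ.+ 2 ℕ.* ∣ X ∣) (m ℕ.+ 2) 0 (begin
            Σrk X ℕ.+ 2 ℕ.* ∣ X ∪ ⁅ e ⁆ ∣ ℕ.+ 0
              ≡⟨ ℕ.+-identityʳ _ ⟩
            Σrk X ℕ.+ 2 ℕ.* ∣ X ∪ ⁅ e ⁆ ∣
              ≤⟨ ℕ.+-mono-≤ (sumℕ-mono λ j → rk-⊆ j (p⊆p∪q ⁅ e ⁆)) (ℕ.*-monoʳ-≤ 2 (∣p∪⁅x⁆∣≤1+∣p∣ X e)) ⟩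
            Σrk (X ∪ ⁅ e ⁆) ℕ.+ 2 ℕ.* ℕ.suc ∣ X ∣
              ≤⟨ ℕ.m≤n+m _ m ⟩
            m ℕ.+ (Σrk (X ∪ ⁅ e ⁆) ℕ.+ 2 ℕ.* ℕ.suc ∣ X ∣)
              ≡⟨ regroup (Σrk (X ∪ ⁅ e ⁆)) m (∣ X ∣) ⟩
            m ℕ.+ 2 ℕ.+ (Σrk (X ∪ ⁅ e ⁆) ℕ.+ 2 ℕ.* ∣ X ∣) ∎))
          where
          flip-sign : ∀ a b → a ℤ.- b ≡ ℤ.- (b ℤ.- a)
          flip-sign = solve-∀
          regroup : ∀ a m b → m ℕ.+ (a ℕ.+ 2 ℕ.* (1 ℕ.+ b)) ≡ m ℕ.+ 2 ℕ.+ (a ℕ.+ 2 ℕ.* b)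
          regroup = ℕ-Solver.solve-∀

-- The algorithm and its polynomial bound

open import Data.Nat.Base using (_+_; _*_; _^_; _≤_)

-- The filter removes the singletons from a = b; every other pair occurs twice, which only affects
-- the count.
pairs : ∀ r → List (Subset r)
pairs r = filter (λ X → 2 ℕ.≤? ∣ X ∣) (cartesianProductWith (λ a b → ⁅ a ⁆ ∪ ⁅ b ⁆) (allFin r) (allFin r))

length-cartesianProductWith : ∀ {A B C : Set} (f : A → B → C) xs ys →
  length (cartesianProductWith f xs ys) ≡ length xs * length ys
length-cartesianProductWith f []       ys = refl
length-cartesianProductWith f (x ∷ xs) ys = trans (List.length-++ (List.map (f x) ys))
  (cong₂ _+_ (List.length-map (f x) ys) (length-cartesianProductWith f xs ys))

length-pairs : ∀ r → length (pairs r) ≤ r * r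
length-pairs r = ℕ.≤-trans (List.length-filter _ (cartesianProductWith (λ a b → ⁅ a ⁆ ∪ ⁅ b ⁆) (allFin r) (allFin r)))
  (ℕ.≤-reflexive (trans (length-cartesianProductWith (λ a b → ⁅ a ⁆ ∪ ⁅ b ⁆) (allFin r) (allFin r))
    (cong₂ _*_ (List.length-tabulate {n = r} id) (List.length-tabulate {n = r} id))))

nonempty : ∀ {n} (S : Subset n) → 1 ≤ ∣ S ∣ → ∃ λ a → a ∈ S
nonempty (true ∷ S)  _ = zero , here
nonempty (false ∷ S) 1≤ = let (a , a∈S) = nonempty S 1≤ in suc a , there a∈S

twoElements : ∀ {n} (S : Subset n) → 2 ≤ ∣ S ∣ → ∃ λ a → ∃ λ b → a ∈ S × b ∈ S × a ≢ b
twoElements (true ∷ S)  (s≤s 1≤) = let (b , b∈S) = nonempty S 1≤ in zero , suc b , here , there b∈S , λ ()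
twoElements (false ∷ S) 2≤ = let (a , b , a∈S , b∈S , a≢b) = twoElements S 2≤ in
  suc a , suc b , there a∈S , there b∈S , a≢b ∘ Fin.suc-injective

∃pair⊆ : ∀ {r} (S : Subset r) → 2 ≤ ∣ S ∣ → ∃ λ X → X ∈ˡ pairs r × X ⊆ S
∃pair⊆ S 2≤ with twoElements S 2≤
... | a , b , a∈S , b∈S , a≢b = ⁅ a ⁆ ∪ ⁅ b ⁆ ,
  ∈-filter⁺ (λ X → 2 ℕ.≤? ∣ X ∣) (∈-cartesianProductWith⁺ (λ a b → ⁅ a ⁆ ∪ ⁅ b ⁆) (∈-allFin a) (∈-allFin b))
    (subst (λ n → n ℕ.< ∣ ⁅ a ⁆ ∪ ⁅ b ⁆ ∣) (∣⁅x⁆∣≡1 a) (∣p∣<∣p∪⁅x⁆∣ (a≢b ∘ sym ∘ x∈⁅y⁆⇒x≡y a))) ,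
  p∪⁅x⁆⊆ (λ x∈a → subst (_∈ S) (sym (x∈⁅y⁆⇒x≡y a x∈a)) a∈S) b∈S

-- A round lowers the potential by at least boxSide; at the start it is at most
-- r * boxSide².
boxSide roundCount : ℕ → ℕ → ℕ
boxSide m r    = 1 + r * ((m + 2) * (m + 2))
roundCount m r = 1 + r * boxSide m r

algorithm : Algorithm
algorithm m r d = Compilation.compile m r d (implement rankProgram (implement slackProgram
    (Descent.search r (boxSide m r) (roundCount m r) (pairs r))))
  where
  open RankProgram m r
  open Slack m r

-- A record, lest the products of numerals be unfolded.
infix 4 _≼_^_·_
record _≼_^_·_ (a x i α : ℕ) : Set where
  constructor ≼-intro
  field bound : a ≤ α * x ^ i

open _≼_^_·_

module _ {x : ℕ} (1≤x : 1 ≤ x) where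

  ≼-* : ∀ {a b i j α β} → a ≼ x ^ i · α → b ≼ x ^ j · β → a * b ≼ x ^ (i + j) · (α * β)
  ≼-* {i = i} {j} {α} {β} (≼-intro a≤) (≼-intro b≤) =
    ≼-intro (ℕ.≤-trans (ℕ.*-mono-≤ a≤ b≤) (ℕ.≤-reflexive (trans
      (regroup α (x ^ i) β (x ^ j)) (cong (λ p → α * β * p) (sym (ℕ.^-distribˡ-+-* x i j))))))
    where
    regroup : ∀ a b c d → a * b * (c * d) ≡ a * c * (b * d)
    regroup = ℕ-Solver.solve-∀

  ≼-+ : ∀ {a b i α β} → a ≼ x ^ i · α → b ≼ x ^ i · β → a + b ≼ x ^ i · (α + β)
  ≼-+ {i = i} {α} {β} (≼-intro a≤) (≼-intro b≤) =
    ≼-intro (ℕ.≤-trans (ℕ.+-mono-≤ a≤ b≤) (ℕ.≤-reflexive (sym (ℕ.*-distribʳ-+ (x ^ i) α β))))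

  ≼-const : ∀ n {i} → n ≼ x ^ i · n
  ≼-const n {i} = ≼-intro (ℕ.≤-trans (ℕ.≤-reflexive (sym (ℕ.*-identityʳ n))) (ℕ.*-monoʳ-≤ n (1≤x^ i)))
    where
    1≤x^ : ∀ i → 1 ≤ x ^ i
    1≤x^ ℕ.zero    = ℕ.≤-refl
    1≤x^ (ℕ.suc i) = ℕ.*-mono-≤ 1≤x (1≤x^ i)

  ≼-base : ∀ {a} → a ≤ x → a ≼ x ^ 1 · 1
  ≼-base a≤x = ≼-intro (ℕ.≤-trans a≤x (ℕ.≤-reflexive (sym (trans (ℕ.+-identityʳ _) (ℕ.*-identityʳ x)))))

  -- As x ≥ 1, every monomial is at most its coefficient times the top power of x, so the constant
  -- is the value of the polynomial with all variables set to 1: here 1 + 3·3 = 10, then 1 + 10 =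
  -- 11, and finally (1 + 11)·(2 + 3) = 60.
  boxSide≼ : ∀ {m r} → m ≤ x → r ≤ x → boxSide m r ≼ x ^ 3 · 10
  boxSide≼ m≤x r≤x = ≼-+ (≼-const 1) (≼-* (≼-base r≤x) (≼-* m+2≼ m+2≼))
    where m+2≼ = ≼-+ (≼-base m≤x) (≼-const 2)

  roundCount≼ : ∀ {m r} → m ≤ x → r ≤ x → roundCount m r ≼ x ^ 4 · 11
  roundCount≼ m≤x r≤x = ≼-+ (≼-const 1) (≼-* (≼-base r≤x) (boxSide≼ m≤x r≤x))

  totalCost≼ : ∀ {m r D} → m ≤ x → r ≤ x → D ≤ x →
    r * r * (1 + roundCount m r * r) * m * r * (D * (r * 2 + D * r * 3)) ≼ x ^ 12 · 60
  totalCost≼ m≤x r≤x D≤x =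
    ≼-* (≼-* (≼-* (≼-* (≼-* r≼ r≼) (≼-+ (≼-const 1) (≼-* (roundCount≼ m≤x r≤x) r≼))) m≼) r≼)
        -- Sums need equal exponents: the constant 2 is given exponent 1, so that r·2 matches the
        -- degree two of D·r·3.
        (≼-* D≼ (≼-+ (≼-* {j = 1} r≼ (≼-const 2)) (≼-* {j = 0} (≼-* D≼ r≼) (≼-const 3))))
    where
    m≼ = ≼-base m≤x
    r≼ = ≼-base r≤x
    D≼ = ≼-base D≤x

-- Abstract, because conversion checking would otherwise expand constant * x ^ degree.
abstract
  constant degree : ℕ
  constant = 60
  degree   = 12

  totalCost≤ : ∀ {x m r D} → 1 ≤ x → m ≤ x → r ≤ x → D ≤ x →
    r * r * (1 + roundCount m r * r) * m * r * (D * (r * 2 + D * r * 3)) ≤ constant * x ^ degree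
  totalCost≤ 1≤x m≤x r≤x D≤x = bound
    (totalCost≼ 1≤x m≤x r≤x D≤x)

-- The assignment inside `execute` is an anonymous pattern-matching function. Quantifying over all
-- `ρ` that agree with `A` lets unification supply it.
execute-runs : ∀ ℝ {m r} {d : Fin m → ℕ} (A : (j : Fin m) → Matrix ℝ (d j) r) (alg : Algorithm) {b B} →
  (∀ ρ → (∀ j a i → ρ (j , a , i) ≡ A j a i) → Runs.Runs ℝ ρ (alg m r d) [] b B) →
  ∃ λ t → execute ℝ alg A ≡ just (b , t) × t ≤ B
execute-runs ℝ A alg alg-runs = let Runs.runs run≡ time≤ = alg-runs _ (λ _ _ _ → refl) in _ , run≡ , time≤

-- Correctness and running time of the algorithm

module Correctness (ℝ : Reals) (m r : ℕ) (d : Fin m → ℕ) (A : (j : Fin m) → Matrix ℝ (d j) r) where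
  open LinearAlgebra ℝ
  open Rank ℝ
  open RankProgram m r
  open Slack m r
  open Descent r (boxSide m r)

  rk : Fin m → Subset r → ℕ
  rk j = rank (A j)

  decide : Search
  decide = search (roundCount m r) (pairs r)

  program : Program Query Bool Bool
  program = implement rankProgram (implement slackProgram decide)

  answer≡ : eval (independenceOracle ℝ A) program ≡ eval (F rk) decide
  answer≡ = trans (eval-implement rankProgram (eval-rankProgram ℝ A) (implement slackProgram decide))
                  (eval-implement slackProgram (eval-slackProgram rk) decide)

  -- At most r·r pairs, each with one initial value and r values per round; m ranks for each value;
  -- r independence tests for each rank.
  cost≤ : cost (independenceOracle ℝ A) program ≤
          r * r * (1 + roundCount m r * r) * m * r
  cost≤ = begin
    cost (independenceOracle ℝ A) program
      ≤⟨ cost-implement rankProgram (eval-rankProgram ℝ A) (cost-rankProgram _) (implement slackProgram decide) ⟩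
    cost (λ (j , S) → rk j S) (implement slackProgram decide) * r
      ≤⟨ ℕ.*-monoˡ-≤ r (cost-implement slackProgram (eval-slackProgram rk) (cost-slackProgram rk) decide) ⟩
    cost (F rk) decide * m * r
      ≤⟨ ℕ.*-monoˡ-≤ r (ℕ.*-monoˡ-≤ m (ℕ.≤-trans (Cost.cost-search (F rk) (roundCount m r) (pairs r))
           (ℕ.*-monoˡ-≤ (1 + roundCount m r * r) (length-pairs r)))) ⟩
    r * r * (1 + roundCount m r * r) * m * r ∎
    where open ℕ.≤-Reasoning

  decide-correct : eval (F rk) decide ≡ true ⇔
    ((S : Subset r) → 2 ≤ ∣ S ∣ → 2 * ∣ S ∣ + m ≤ sumℕ (λ j → rk j S) + 1)
  decide-correct = mk⇔ complete sound
    where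
    sound : (∀ S → 2 ≤ ∣ S ∣ → 2 * ∣ S ∣ + m ≤ sumℕ (λ j → rk j S) + 1) → eval (F rk) decide ≡ true
    sound holds = Soundness.search-true (F rk) (λ X 2≤ → Equivalence.from (0≤F⇔ rk X) (holds X 2≤)) (roundCount m r)
      (All.all-filter (λ X → 2 ℕ.≤? ∣ X ∣) (cartesianProductWith (λ a b → ⁅ a ⁆ ∪ ⁅ b ⁆) (allFin r) (allFin r)))

    complete : eval (F rk) decide ≡ true → ∀ S → 2 ≤ ∣ S ∣ → 2 * ∣ S ∣ + m ≤ sumℕ (λ j → rk j S) + 1
    complete eval≡true S 2≤ with 0ℤ ℤ.≤? F rk S
    ... | yes 0≤F = Equivalence.to (0≤F⇔ rk S) 0≤F
    ... | no  0≰F = let (X , X∈ , X⊆S) = ∃pair⊆ S 2≤ in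
      contradiction (trans (sym eval≡true) (search-false X∈ X⊆S)) λ ()
      where
      open Completeness (F rk)
        (F-submodular rk (λ j → rank-⊆ (A j)) (λ j → rank-∪⁅⁆≤ (A j)) (λ j → rank-submodular (A j)))
        ((m + 2) * (m + 2))
        (F-increment² rk (λ j → rank-⊆ (A j)) (λ j → rank-∪⁅⁆≤ (A j)) (λ j → rank-submodular (A j)))
        refl S (ℤ.≰⇒> 0≰F)

  program-correct : eval (independenceOracle ℝ A) program ≡ true ⇔
    ((S : Subset r) → 2 ≤ ∣ S ∣ → 2 * ∣ S ∣ + m ≤ sumℕ (λ j → rank (A j) S) + 1)
  program-correct = mk⇔ (Equivalence.to decide-correct ∘ trans (sym answer≡))
                        (trans answer≡ ∘ Equivalence.from decide-correct)

  runs-program : ∀ x → 1 ≤ x → m ≤ x → r ≤ x → sumℕ d ≤ x →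
    (ρ : Entry m r d → Reals.Carrier ℝ) → (∀ j a i → ρ (j , a , i) ≡ A j a i) →
    Runs.Runs ℝ ρ (algorithm m r d) [] (eval (independenceOracle ℝ A) program) (constant * x ^ degree)
  runs-program x 1≤x m≤x r≤x D≤x ρ ρ≡A =
    Runs.runs-≤ ℝ ρ total≤ (runs-compile ℝ A ρ ρ≡A test≤ program)
    where
    D test : ℕ
    D    = sumℕ d
    test = D * (r * 2 + D * r * 3)

    test≤ : ∀ j → testCost (d j) r ≤ test
    test≤ j = ℕ.≤-trans (testCost≤ r (member≤sumℕ d j)) (ℕ.*-monoˡ-≤ _ (member≤sumℕ d j))

    total≤ : cost (independenceOracle ℝ A) program * test ≤ constant * x ^ degree
    total≤ = ℕ.≤-trans (ℕ.*-monoˡ-≤ test cost≤) (totalCost≤ 1≤x m≤x r≤x D≤x)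

claim4p1 : ∃ λ (alg : Algorithm) → ∃ λ (C : ℕ) → ∃ λ (k : ℕ) →
    ((ℝ : Reals) → let open LinearAlgebra ℝ in
    (m r : ℕ) (d : Fin m → ℕ) (A : (j : Fin m) → Matrix ℝ (d j) r) →
    (∀ j → rank (A j) ⊤ ≡ d j) → (∀ j → 1 ≤ d j) →
    ∃[ b ] ∃[ t ]
    (execute ℝ alg A ≡ just (b , t) ×
    (b ≡ true ⇔
    ((S : Subset r) → 2 ≤ ∣ S ∣ →
    2 * ∣ S ∣ + m ≤ sumℕ (λ j → rank (A j) S) + 1)) ×
    t ≤ C * (1 + sumℕ (λ j → rank (A j) ⊤) + r) ^ k))
claim4p1 = algorithm , constant , degree , λ ℝ m r d A full-rank 1≤d →
  let open LinearAlgebra ℝ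
      open Correctness ℝ m r d A
      -- Full rank identifies the numbers of rows, which govern the time of the tests, with the
      -- ranks that make up D.
      D≤x : sumℕ d ≤ 1 + sumℕ (λ j → rank (A j) ⊤) + r
      D≤x = ℕ.≤-trans (ℕ.≤-reflexive (sym (sumℕ-cong full-rank))) (ℕ.m≤n⇒m≤1+n (ℕ.m≤m+n _ r))
      (t , execute≡ , time≤) = execute-runs ℝ A algorithm
        (runs-program (1 + sumℕ (λ j → rank (A j) ⊤) + r) (s≤s z≤n)
          -- The number of matrices is bounded by D because each has at least one row.
          (ℕ.≤-trans (size≤sumℕ d 1≤d) D≤x) (ℕ.m≤n+m r _) D≤x)
  in eval (independenceOracle ℝ A) program , t , execute≡ , program-correct , time≤
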